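{- Let $q$ be a prime power, let $n\ge 2$ be an integer, and let $G$ be the additive group of $\mathbb{F}_q^n$. Let $\mathbb{F}_q^*$ act on $G$ by scalar multiplication and put $K:=\mathbb{F}_q^n\rtimes\mathbb{F}_q^*$, viewed as the group of permutations $x\mapsto \lambda x+b$ ($\lambda\in\mathbb{F}_q^*$, $b\in\mathbb{F}_q^n$) of $\mathbb{F}_q^n$; here $G$ is identified with the subgroup of translations $x\mapsto x+b$. Let $S\subseteq G$ with $S=-S$, and let $\Gamma=\mathrm{Cay}(G,S)$. If $K\le \mathrm{Aut}(\Gamma)$, then either (i) $\mathrm{Aut}(\Gamma)=K$, or (ii) there exists $\varphi\in\mathrm{Aut}(\Gamma)\setminus K$ that normalizes $G$ (i.e. $\varphi G\varphi^{ -1}=G$ in the group of permutations of $\mathbb{F}_q^n$).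
   Context: For an abelian group $A$ (written additively) and an inverse-closed subset $S\subseteq A$ (i.e. $S=-S$), the Cayley graph $\mathrm{Cay}(A,S)$ has vertex set $A$, with $u,v$ adjacent iff $u-v\in S$. $\mathrm{Aut}(\Gamma)$ denotes the full automorphism group of the graph $\Gamma$, regarded as a group of permutations of its vertex set. -}

module Defs where

open import Level using (Level; 0ℓ)
open import Data.Nat using (ℕ)
open import Data.Fin using (Fin)
open import Data.Bool using (Bool; true)
open import Data.Vec using (Vec; map; zipWith)
open import Data.Product using (Σ; ∃; ∃-syntax; _×_; _,_)
open import Relation.Nullary using (¬_)
open import Relation.Binary.PropositionalEquality using (_≡_)
open import Relation.Binary.Definitions using (DecidableEquality)
open import Algebra.Structures using (IsCommutativeRing)
open import Function.Bundles using (_↔_; Inverse; _⇔_)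

-- A finite field, with propositional equality.  Its cardinality q is then
-- necessarily a prime power, and every prime power arises (F_q).
record FiniteField : Set₁ where
  field
    Carrier : Set
    _+_ _*_ : Carrier → Carrier → Carrier
    -_      : Carrier → Carrier
    0# 1#   : Carrier
    isCommutativeRing : IsCommutativeRing _≡_ _+_ _*_ -_ 0# 1#
    0≢1     : ¬ (0# ≡ 1#)
    inverse : ∀ x → ¬ (x ≡ 0#) → ∃[ y ] (x * y ≡ 1#)
    _≟_     : DecidableEquality Carrier
    q       : ℕ
    enum    : Fin q ↔ Carrier

module _ (F : FiniteField) where
  open FiniteField F

  V : ℕ → Set
  V n = Vec Carrier n

  _⊕_ : ∀ {n} → V n → V n → V n
  _⊕_ = zipWith _+_

  ⊖_ : ∀ {n} → V n → V n
  ⊖_ = map -_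

  _⊖_ : ∀ {n} → V n → V n → V n
  x ⊖ y = x ⊕ (⊖ y)

  _·_ : ∀ {n} → Carrier → V n → V n
  c · x = map (c *_) x

  Adj : ∀ {n} → (V n → Bool) → V n → V n → Set
  Adj S u v = S (u ⊖ v) ≡ true

  Perm : ℕ → Set
  Perm n = V n ↔ V n

  IsAut : ∀ {n} → (V n → Bool) → Perm n → Set
  IsAut S φ = ∀ u v → Adj S u v ⇔ Adj S (Inverse.to φ u) (Inverse.to φ v)

  InK : ∀ {n} → Perm n → Set
  InK {n} φ = Σ Carrier λ c → ¬ (c ≡ 0#) × Σ (V n) λ b →
                ∀ x → Inverse.to φ x ≡ (c · x) ⊕ b

  -- every affine map x ↦ λx + b (λ ≠ 0) is an automorphism (as a map;
  -- such maps are bijections), i.e. K ≤ Aut(Γ)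
  KLeAut : ∀ {n} → (V n → Bool) → Set
  KLeAut {n} S = ∀ c → ¬ (c ≡ 0#) → (b : V n) → ∀ u v →
                   Adj S u v ⇔ Adj S ((c · u) ⊕ b) ((c · v) ⊕ b)

  NormalizesG : ∀ {n} → Perm n → Set
  NormalizesG {n} φ =
    (∀ (b : V n) → ∃[ c ] ∀ x → Inverse.to φ (Inverse.from φ x ⊕ b) ≡ x ⊕ c)
    × (∀ (c : V n) → ∃[ b ] ∀ x → Inverse.to φ (Inverse.from φ x ⊕ b) ≡ x ⊕ c)

-- Suppose every automorphism that normalizes G lies in K.  If S is constant off 0, then
-- swapping two coordinates is an automorphism, which contradicts this.  Otherwise:
--
-- (1) Burnside transfer shows that the centralizer in A = Aut Γ of a translation ≠ 1 is G.
--     Hence distinct conjugates of G meet trivially, and an element of A that conjugates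
--     some translation ≠ 1 to a translation lies in K.
-- (2) Let z be an A-invariant function on 𝔽_q^n with z(0) = 0 and ∑ z = 0, and put
--     M(a) = ∑_x z(ax − x).  The conjugates of the translation by g contribute q^{2n} z(g)²
--     each to Q = ∑_{a ∈ A} M(a)², so that (1) bounds Q from below.  Expanding
--         0 ≤ ∑_{a,r,b} (Z(b, ar − a0) − Z(b, r))²,   Z(b,r) = ∑_{λ ≠ 0} z(b − λr),
--     bounds Q from above by the same quantity.  So Z(b, ar − a0) = Z(b, r).
-- (3) For z = N·1_{S∖0} + s·1_0 − s with N = q^n − 1 and s = |S ∖ 0|, taking b = r gives
--     N ∣ s unless r is a multiple of ar − a0.  As 0 < s < N, each a ∈ A preserves the
--     direction of every line, and for n ≥ 2 this makes it x ↦ λx + b.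
module Submission where

open import Defs
open import Algebra.Bundles using (CommutativeRing)
import Algebra.Properties.AbelianGroup
import Algebra.Properties.Ring
import Algebra.Properties.Semiring.Mult
import Algebra.Solver.Ring
open import Algebra.Solver.Ring.AlmostCommutativeRing using (fromCommutativeRing; _-Raw-AlmostCommutative⟶_)
open import Algebra.Structures using (IsCommutativeMonoid; IsCommutativeRing)
open import Data.Bool.Base using (Bool; true; false; if_then_else_; not)
import Data.Bool.Properties as Boolₚ
open import Data.Empty using (⊥-elim)
open import Data.Fin.Base as Fin using (Fin)
open import Data.Integer.Base as ℤ using (ℤ; +_; -[1+_]; 0ℤ; 1ℤ)
import Data.Integer.Properties as ℤₚ
import Data.Integer.Solver as ℤSolver
open import Data.List.Base as List
  using (List; []; _∷_; _++_; map; filter; length; cartesianProduct; cartesianProductWith; downFrom; allFin)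
open import Data.List.Membership.Propositional using (_∈_; _∉_)
open import Data.List.Membership.Propositional.Properties
open import Data.List.Membership.Propositional.Properties.WithK using (unique∧set⇒bag)
import Data.List.Properties as Listₚ
import Data.List.Relation.Binary.BagAndSetEquality as BagSet
open import Data.List.Relation.Binary.Permutation.Propositional as Perm using (_↭_)
import Data.List.Relation.Binary.Permutation.Propositional.Properties as Permₚ
open import Data.List.Relation.Binary.Pointwise as Pointwise using (Pointwise; []; _∷_)
open import Data.List.Relation.Unary.All as All using (All; []; _∷_)
open import Data.List.Relation.Unary.AllPairs using ([]; _∷_)
open import Data.List.Relation.Unary.Any as Any using (here; there)
import Data.List.Relation.Unary.Any.Properties as Anyₚ
open import Data.List.Relation.Unary.Unique.Propositional using (Unique)
import Data.List.Relation.Unary.Unique.Propositional.Properties as Uniqueₚ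
import Data.Maybe.Base as Maybe
open import Data.Nat.Base as ℕ using (ℕ; zero; suc; _≥_)
import Data.Nat.DivMod as DivMod
import Data.Nat.Induction as ℕᵢ
import Data.Nat.Properties as ℕₚ
open import Data.Product.Base using (Σ; ∃; _×_; _,_; proj₁; proj₂)
import Data.Sign.Base as Sign
open import Data.Sum.Base using (_⊎_; inj₁; inj₂; [_,_]′)
open import Data.Vec.Base as Vec using (Vec; []; _∷_)
import Data.Vec.Properties as Vecₚ
open import Function.Base using (_∘_; id)
open import Function.Bundles using (Inverse; Equivalence; mk⇔; mk↔ₛ′)
open import Level using (0ℓ)
open import Relation.Binary.Consequences using (dec⇒weaklyDec)
open import Relation.Binary.Definitions using (DecidableEquality)
open import Relation.Binary.PropositionalEquality as ≡
  using (_≡_; _≢_; refl; sym; trans; cong; cong₂; subst; subst₂; module ≡-Reasoning)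
open import Relation.Nullary using (Dec; yes; no; ¬_; ¬?; does)
open import Relation.Nullary.Decidable using (map′; _×-dec_; decidable-stable)
open import Relation.Unary using (Pred; Decidable)

-- The two bounds on Q meet because of the sum over scalars. Put ζ = ∑ z². A conjugate of a
-- translation can arise from |K| = (q - 1)q^n pairs (a, g), so counting conjugates gives only Q ≥
-- |A|q^n ζ/(q - 1), whereas squaring z(b - (ar - a0)) - z(b - r) without scalars gives Q ≤ |A|q^n
-- ζ. Summing over λ closes this gap of q - 1. In the two square terms different scalars λ ≠ μ are
-- uncorrelated: (b - λr, b - μr) runs over all pairs of vectors and ∑ z = 0, so only q - 1 of the
-- (q - 1)² products survive. In the mixed term all (q - 1)² survive, each equal to Q, because K ≤ A
-- absorbs the scalars into a. The condition z(0) = 0 discards the identity, which is a conjugate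
-- for all of A at once.
--
-- The transfer says something about a translation only if its conjugates under the point stabilizer
-- are understood. Therefore centralizers of whole families of translations are treated, from large
-- families down to small ones: if the centralizers of all enlarged families are G, a stabilizer
-- element that conjugates an outside translation to a translation normalizes G, hence lies in K.

private module ℤ-Group = Algebra.Properties.AbelianGroup ℤₚ.+-0-abelianGroup

private variable
  I J L : Set


-- Finite enumerations and sums over lists

record Enumeration (A : Set) : Set where
  field
    elements : List A
    complete : ∀ x → x ∈ elements
    unique   : Unique elements

  any? : {P : A → Set} → Decidable P → Dec (∃ P)
  any? P? with Any.any? P? elements
  ... | yes p = yes (Any.satisfied p)
  ... | no ¬p = no λ (x , px) → ¬p (Any.map (λ { refl → px }) (complete x))

  all? : {P : A → Set} → Decidable P → Dec (∀ x → P x)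
  all? P? with All.all? P? elements
  ... | yes p = yes λ x → All.lookup p (complete x)
  ... | no ¬p = no λ p → ¬p (All.tabulate λ {x} _ → p x)

unique-↭ : {xs ys : List I} → Unique xs → Unique ys →
           (∀ {x} → x ∈ xs → x ∈ ys) → (∀ {x} → x ∈ ys → x ∈ xs) → xs ↭ ys
unique-↭ xs! ys! ⊆ ⊇ = BagSet.∼bag⇒↭ (unique∧set⇒bag xs! ys! (mk⇔ ⊆ ⊇))

unique-map : {f : I → J} {xs : List I} →
             (∀ {x y} → x ∈ xs → y ∈ xs → f x ≡ f y → x ≡ y) →
             Unique xs → Unique (map f xs)
unique-map {xs = []} inj [] = []
unique-map {f = f} {xs = x ∷ xs} inj (x∉ ∷ xs!) =
  All.tabulate (λ fy∈ fx≡ → let (y , y∈ , eq) = ∈-map⁻ f fy∈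
                             in All.lookup x∉ y∈ (inj (here refl) (there y∈) (trans fx≡ eq)))
  ∷ unique-map (λ x∈ y∈ → inj (there x∈) (there y∈)) xs!

filter-length-≤ : {P Q : Pred I 0ℓ} (P? : Decidable P) (Q? : Decidable Q) →
                  (∀ {x} → Q x → P x) → ∀ xs →
                  length (filter Q? xs) ℕ.≤ length (filter P? xs)
filter-length-≤ P? Q? Q⇒P [] = ℕ.z≤n
filter-length-≤ P? Q? Q⇒P (y ∷ ys) with P? y | Q? y
... | yes _ | yes _ = ℕ.s≤s (filter-length-≤ P? Q? Q⇒P ys)
... | yes _ | no  _ = ℕₚ.m≤n⇒m≤1+n (filter-length-≤ P? Q? Q⇒P ys)
... | no ¬p | yes q = ⊥-elim (¬p (Q⇒P q))
... | no  _ | no  _ = filter-length-≤ P? Q? Q⇒P ys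

filter-length-< : {P Q : Pred I 0ℓ} (P? : Decidable P) (Q? : Decidable Q) →
                  (∀ {x} → Q x → P x) → ∀ xs {x} → x ∈ xs → P x → ¬ Q x →
                  length (filter Q? xs) ℕ.< length (filter P? xs)
filter-length-< P? Q? Q⇒P (y ∷ ys) x∈ px ¬qx with P? y | Q? y | x∈
... | yes _ | yes q | here refl = ⊥-elim (¬qx q)
... | yes _ | yes _ | there x∈′ = ℕ.s≤s (filter-length-< P? Q? Q⇒P ys x∈′ px ¬qx)
... | yes _ | no  _ | _         = ℕ.s≤s (filter-length-≤ P? Q? Q⇒P ys)
... | no ¬p | yes q | _         = ⊥-elim (¬p (Q⇒P q))
... | no ¬p | no  _ | here refl = ⊥-elim (¬p px)
... | no  _ | no  _ | there x∈′ = filter-length-< P? Q? Q⇒P ys x∈′ px ¬qx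

module Summation {M : Set} {_∙_ : M → M → M} {ε : M}
                 (isCommutativeMonoid : IsCommutativeMonoid _≡_ _∙_ ε) where
  open IsCommutativeMonoid isCommutativeMonoid using (assoc; comm; identityˡ; identityʳ)
  open ≡-Reasoning

  ∑ : List I → (I → M) → M
  ∑ []       f = ε
  ∑ (x ∷ xs) f = f x ∙ ∑ xs f

  private
    exchange : ∀ a b c d → (a ∙ b) ∙ (c ∙ d) ≡ (a ∙ c) ∙ (b ∙ d)
    exchange a b c d = begin
      (a ∙ b) ∙ (c ∙ d)  ≡⟨ assoc a b _ ⟩
      a ∙ (b ∙ (c ∙ d))  ≡⟨ cong (a ∙_) (sym (assoc b c d)) ⟩
      a ∙ ((b ∙ c) ∙ d)  ≡⟨ cong (λ e → a ∙ (e ∙ d)) (comm b c) ⟩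
      a ∙ ((c ∙ b) ∙ d)  ≡⟨ cong (a ∙_) (assoc c b d) ⟩
      a ∙ (c ∙ (b ∙ d))  ≡⟨ sym (assoc a c _) ⟩
      (a ∙ c) ∙ (b ∙ d)  ∎

    left-comm : ∀ a b c → a ∙ (b ∙ c) ≡ b ∙ (a ∙ c)
    left-comm a b c = trans (sym (assoc a b c)) (trans (cong (_∙ c) (comm a b)) (assoc b a c))

  ∑-cong : ∀ (xs : List I) {f g : I → M} → (∀ {x} → x ∈ xs → f x ≡ g x) → ∑ xs f ≡ ∑ xs g
  ∑-cong []       eq = refl
  ∑-cong (x ∷ xs) eq = cong₂ _∙_ (eq (here refl)) (∑-cong xs (eq ∘ there))

  ∑-cong-≗ : ∀ (xs : List I) {f g : I → M} → (∀ x → f x ≡ g x) → ∑ xs f ≡ ∑ xs g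
  ∑-cong-≗ xs eq = ∑-cong xs (λ {x} _ → eq x)

  ∑-ε : ∀ (xs : List I) {f : I → M} → (∀ {x} → x ∈ xs → f x ≡ ε) → ∑ xs f ≡ ε
  ∑-ε []       eq = refl
  ∑-ε (x ∷ xs) eq = trans (cong₂ _∙_ (eq (here refl)) (∑-ε xs (eq ∘ there))) (identityˡ ε)

  ∑-distrib : ∀ (xs : List I) (f g : I → M) → ∑ xs (λ x → f x ∙ g x) ≡ ∑ xs f ∙ ∑ xs g
  ∑-distrib []       f g = sym (identityˡ ε)
  ∑-distrib (x ∷ xs) f g = trans (cong (_ ∙_) (∑-distrib xs f g)) (exchange _ _ _ _)

  ∑-swap : ∀ (xs : List I) (ys : List J) (f : I → J → M) →
           ∑ xs (λ x → ∑ ys (f x)) ≡ ∑ ys (λ y → ∑ xs (λ x → f x y))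
  ∑-swap []       ys f = sym (∑-ε ys (λ _ → refl))
  ∑-swap (x ∷ xs) ys f =
    trans (cong (_ ∙_) (∑-swap xs ys f)) (sym (∑-distrib ys (f x) _))

  ∑-map : ∀ (σ : I → J) xs (f : J → M) → ∑ (map σ xs) f ≡ ∑ xs (f ∘ σ)
  ∑-map σ []       f = refl
  ∑-map σ (x ∷ xs) f = cong (_ ∙_) (∑-map σ xs f)

  ∑-++ : ∀ (xs ys : List I) (f : I → M) → ∑ (xs ++ ys) f ≡ ∑ xs f ∙ ∑ ys f
  ∑-++ []       ys f = sym (identityˡ _)
  ∑-++ (x ∷ xs) ys f = trans (cong (_ ∙_) (∑-++ xs ys f)) (sym (assoc _ _ _))

  ∑-↭ : ∀ {xs ys : List I} → xs ↭ ys → (f : I → M) → ∑ xs f ≡ ∑ ys f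
  ∑-↭ Perm.refl         f = refl
  ∑-↭ (Perm.prep x p)   f = cong (_ ∙_) (∑-↭ p f)
  ∑-↭ (Perm.trans p q)  f = trans (∑-↭ p f) (∑-↭ q f)
  ∑-↭ (Perm.swap x y p) f = trans (cong (λ s → f x ∙ (f y ∙ s)) (∑-↭ p f))
    (left-comm _ _ _)

  ∑-reindex : ∀ {xs : List I} → Unique xs → (σ σ⁻¹ : I → I) →
              (∀ {x} → x ∈ xs → σ x ∈ xs) → (∀ {x} → x ∈ xs → σ⁻¹ x ∈ xs) →
              (∀ {x} → x ∈ xs → σ (σ⁻¹ x) ≡ x) → (∀ {x} → x ∈ xs → σ⁻¹ (σ x) ≡ x) →
              (f : I → M) → ∑ xs (f ∘ σ) ≡ ∑ xs f
  ∑-reindex {xs = xs} xs! σ σ⁻¹ σ-closed σ⁻¹-closed σσ⁻¹ σ⁻¹σ f =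
    trans (sym (∑-map σ xs f)) (∑-↭ map-↭ f)
    where
    map-↭ : map σ xs ↭ xs
    map-↭ = unique-↭
      (unique-map (λ x∈ y∈ eq → trans (sym (σ⁻¹σ x∈)) (trans (cong σ⁻¹ eq) (σ⁻¹σ y∈))) xs!) xs!
      (λ y∈ → let (x , x∈ , eq) = ∈-map⁻ σ y∈ in subst (_∈ xs) (sym eq) (σ-closed x∈))
      (λ y∈ → subst (_∈ map σ xs) (σσ⁻¹ y∈) (∈-map⁺ σ (σ⁻¹-closed y∈)))

  ∑-single : ∀ {xs : List I} → Unique xs → ∀ {c} → c ∈ xs → (f : I → M) →
             (∀ {x} → x ∈ xs → x ≢ c → f x ≡ ε) → ∑ xs f ≡ f c
  ∑-single {xs = _ ∷ xs} (x∉ ∷ _) (here refl) f vanish = trans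
    (cong (_ ∙_) (∑-ε xs λ y∈ → vanish (there y∈) (All.lookup x∉ y∈ ∘ sym))) (identityʳ _)
  ∑-single (x∉ ∷ xs!) (there c∈) f vanish = trans
    (cong₂ _∙_ (vanish (here refl) (All.lookup x∉ c∈)) (∑-single xs! c∈ f (vanish ∘ there)))
    (identityˡ _)

  ∑-filter : ∀ {P : Pred I 0ℓ} (P? : Decidable P) xs (f : I → M) →
             ∑ xs f ≡ ∑ (filter P? xs) f ∙ ∑ (filter (¬? ∘ P?) xs) f
  ∑-filter P? []       f = sym (identityˡ ε)
  ∑-filter P? (x ∷ xs) f with P? x
  ... | yes _ = trans (cong (f x ∙_) (∑-filter P? xs f)) (sym (assoc _ _ _))
  ... | no  _ = trans (cong (f x ∙_) (∑-filter P? xs f))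
    (left-comm _ _ _)

  module _ (_≟_ : DecidableEquality J) (B : List I) (B! : Unique B)
           (act : I → J → J) (f : J → M) where
    open import Data.List.Membership.DecPropositional _≟_ using (_∈?_)

    -- A free action stripped of its group: `divide` replaces multiplication by an inverse, and
    -- `unit` the neutral element. The intended `B` is the list of residues below `p`, acting
    -- through multiples of a fixed vector; of the group law modulo `p` only the existence of
    -- differences is then required.
    record FreeOn (T : List J) : Set where
      field
        closed  : ∀ {b t} → b ∈ B → t ∈ T → act b t ∈ T
        unit    : ∀ {t} → t ∈ T → ∃ λ b → b ∈ B × act b t ≡ t
        divide  : ∀ {b c s t} → b ∈ B → c ∈ B → s ∈ T → t ∈ T → act b s ≡ act c t →
                  ∃ λ d → d ∈ B × act d t ≡ s
        free    : ∀ {b c t} → b ∈ B → c ∈ B → t ∈ T → act b t ≡ act c t → b ≡ c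
        ∑-orbit : ∀ {t} → t ∈ T → ∑ B (λ b → f (act b t)) ≡ ε

    -- The orbit `O` of the first element is split off. By `free` it is listed without repetition,
    -- so its sum is that of `∑-orbit`; the rest is shorter and inherits `FreeOn`. In `go`, `m`
    -- bounds the length.
    ∑-free-orbits : ∀ T → Unique T → FreeOn T → ∑ T f ≡ ε
    ∑-free-orbits T = go (length T) T ℕₚ.≤-refl
      where
      go : ∀ m T → length T ℕ.≤ m → Unique T → FreeOn T → ∑ T f ≡ ε
      go m       []          _           T! on-T = refl
      go (suc m) T@(t₀ ∷ _) (ℕ.s≤s T≤m) T! on-T = begin
        ∑ T f              ≡⟨ ∑-filter (_∈? O) T f ⟩
        ∑ T∩O f ∙ ∑ T∖O f  ≡⟨ cong₂ _∙_ ∑O≡ε (go m T∖O T∖O≤m (Uniqueₚ.filter⁺ ∉O? T!) on-T∖O) ⟩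
        ε ∙ ε              ≡⟨ identityˡ ε ⟩
        ε                  ∎
        where
        open FreeOn on-T

        O : List J
        O = map (λ b → act b t₀) B

        ∉O? : Decidable (_∉ O)
        ∉O? = ¬? ∘ (_∈? O)

        T∩O T∖O : List J
        T∩O = filter (_∈? O) T
        T∖O = filter ∉O? T

        t₀∈O : t₀ ∈ O
        t₀∈O = let (b , b∈ , eq) = unit (here refl) in subst (_∈ O) eq (∈-map⁺ _ b∈)

        T∖O≤m : length T∖O ℕ.≤ m
        T∖O≤m = ℕₚ.≤-pred (ℕₚ.≤-trans
          (Listₚ.filter-notAll ∉O? T (here λ ¬p → ¬p t₀∈O)) (ℕ.s≤s T≤m))

        ⊆T : ∀ {x} → x ∈ T∖O → x ∈ T
        ⊆T x∈ = proj₁ (∈-filter⁻ ∉O? x∈)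

        on-T∖O : FreeOn T∖O
        on-T∖O = record
          { closed  = closed′
          ; unit    = unit ∘ ⊆T
          ; divide  = λ b∈ c∈ s∈ t∈ → divide b∈ c∈ (⊆T s∈) (⊆T t∈)
          ; free    = λ b∈ c∈ t∈ → free b∈ c∈ (⊆T t∈)
          ; ∑-orbit = ∑-orbit ∘ ⊆T
          }
          where
          closed′ : ∀ {b t} → b ∈ B → t ∈ T∖O → act b t ∈ T∖O
          closed′ {b} {t} b∈ t∈ with ∈-filter⁻ ∉O? {xs = T} t∈
          ... | t∈T , t∉O = ∈-filter⁺ ∉O? (closed b∈ t∈T) λ bt∈O →
            -- If `act b t` were in the orbit of `t₀`, then `divide` would put `t` there as well.
            let (c , c∈ , eq)  = ∈-map⁻ _ bt∈O
                (d , d∈ , eq′) = divide b∈ c∈ t∈T (here refl) eq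
            in t∉O (subst (_∈ O) eq′ (∈-map⁺ _ d∈))

        T∩O↭O : T∩O ↭ O
        T∩O↭O = unique-↭ (Uniqueₚ.filter⁺ (_∈? O) T!)
          (unique-map (λ b∈ c∈ → free b∈ c∈ (here refl)) B!)
          (λ x∈ → proj₂ (∈-filter⁻ (_∈? O) {xs = T} x∈))
          (λ x∈O → let (b , b∈ , eq) = ∈-map⁻ _ x∈O in
            ∈-filter⁺ (_∈? O) (subst (_∈ T) (sym eq) (closed b∈ (here refl))) x∈O)

        ∑O≡ε : ∑ T∩O f ≡ ε
        ∑O≡ε = trans (∑-↭ T∩O↭O f) (trans (∑-map _ B f) (∑-orbit (here refl)))

unique-⊆-length : {xs ys : List I} → Unique xs → (∀ {x} → x ∈ xs → x ∈ ys) →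
                  length xs ℕ.≤ length ys
unique-⊆-length [] _ = ℕ.z≤n
unique-⊆-length {xs = x ∷ xs} (x∉ ∷ xs!) ⊆ with ∈-∃++ (⊆ (here refl))
... | ys₁ , ys₂ , refl = subst (_ ℕ.≤_) (sym (Permₚ.↭-length (Permₚ.shift x ys₁ ys₂)))
  (ℕ.s≤s (unique-⊆-length xs! λ y∈ →
    drop-x (All.lookup x∉ y∈) (Permₚ.∈-resp-↭ (Permₚ.shift x ys₁ ys₂) (⊆ (there y∈)))))
  where
  drop-x : ∀ {y} → x ≢ y → y ∈ x ∷ ys₁ ++ ys₂ → y ∈ ys₁ ++ ys₂
  drop-x x≢y (here y≡x) = ⊥-elim (x≢y (sym y≡x))
  drop-x x≢y (there y∈) = y∈

length-cartesianProductWith : ∀ {K : Set} (f : I → J → K) xs ys →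
  length (cartesianProductWith f xs ys) ≡ length xs ℕ.* length ys
length-cartesianProductWith f []       ys = refl
length-cartesianProductWith f (x ∷ xs) ys = trans (Listₚ.length-++ (map (f x) ys))
  (cong₂ ℕ._+_ (Listₚ.length-map (f x) ys) (length-cartesianProductWith f xs ys))
  where import Data.List.Properties as Listₚ

-- Integer sums, positivity and double counting

module IntegerSums where
  open Summation ℤₚ.+-0-isCommutativeMonoid public
  open import Data.Integer.Base using (_+_; _*_; _≤_; +≤+)

  *-∑ : ∀ c xs (f : I → ℤ) → c * ∑ xs f ≡ ∑ xs (λ x → c * f x)
  *-∑ c []       f = ℤₚ.*-zeroʳ c
  *-∑ c (x ∷ xs) f = trans (ℤₚ.*-distribˡ-+ c (f x) _) (cong (λ s → c * f x + s) (*-∑ c xs f))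

  ∑-* : ∀ xs (f : I → ℤ) c → ∑ xs f * c ≡ ∑ xs (λ x → f x * c)
  ∑-* []       f c = ℤₚ.*-zeroˡ c
  ∑-* (x ∷ xs) f c = trans (ℤₚ.*-distribʳ-+ c (f x) _) (cong (λ s → f x * c + s) (∑-* xs f c))

  ∑-*-∑ : ∀ xs (f : I → ℤ) ys (g : J → ℤ) →
          ∑ xs f * ∑ ys g ≡ ∑ xs (λ x → ∑ ys (λ y → f x * g y))
  ∑-*-∑ xs f ys g = trans (∑-* xs f _) (∑-cong-≗ xs λ x → *-∑ (f x) ys g)

  ∑-const : ∀ (xs : List I) c → ∑ xs (λ _ → c) ≡ + length xs * c
  ∑-const []       c = sym (ℤₚ.*-zeroˡ c)
  ∑-const (x ∷ xs) c = trans (cong (λ s → c + s) (∑-const xs c)) (sym (ℤₚ.suc-* (+ length xs) c))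

  ∑-if : ∀ {P : Pred I 0ℓ} (P? : Decidable P) xs c →
         ∑ xs (λ x → if does (P? x) then c else 0ℤ) ≡ + length (filter P? xs) * c
  ∑-if P? []       c = sym (ℤₚ.*-zeroˡ c)
  ∑-if P? (x ∷ xs) c with P? x
  ... | yes _ = trans (cong (λ s → c + s) (∑-if P? xs c)) (sym (ℤₚ.suc-* (+ length (filter P? xs)) c))
  ... | no  _ = trans (ℤₚ.+-identityˡ _) (∑-if P? xs c)

  ∑-mono : ∀ (xs : List I) {f g : I → ℤ} → (∀ x → f x ≤ g x) → ∑ xs f ≤ ∑ xs g
  ∑-mono []       f≤g = ℤₚ.≤-refl
  ∑-mono (x ∷ xs) f≤g = ℤₚ.+-mono-≤ (f≤g x) (∑-mono xs f≤g)

  ∑-nonNeg : ∀ (xs : List I) {f : I → ℤ} → (∀ x → 0ℤ ≤ f x) → 0ℤ ≤ ∑ xs f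
  ∑-nonNeg []       0≤f = ℤₚ.≤-refl
  ∑-nonNeg (x ∷ xs) 0≤f = ℤₚ.+-mono-≤ (0≤f x) (∑-nonNeg xs 0≤f)

  ∑-nonNeg-vanish : ∀ (xs : List I) {f : I → ℤ} → (∀ x → 0ℤ ≤ f x) → ∑ xs f ≤ 0ℤ →
                    ∀ {x} → x ∈ xs → f x ≡ 0ℤ
  ∑-nonNeg-vanish (x ∷ xs) {f} 0≤f ∑≤0 (here refl) = ℤₚ.≤-antisym
    (ℤₚ.≤-trans (subst (_≤ f x + ∑ xs f) (ℤₚ.+-identityʳ (f x))
      (ℤₚ.+-monoʳ-≤ (f x) (∑-nonNeg xs 0≤f))) ∑≤0) (0≤f x)
  ∑-nonNeg-vanish (x ∷ xs) {f} 0≤f ∑≤0 (there y∈) = ∑-nonNeg-vanish xs 0≤f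
    (ℤₚ.≤-trans (subst (_≤ f x + ∑ xs f) (ℤₚ.+-identityˡ (∑ xs f))
      (ℤₚ.+-monoˡ-≤ (∑ xs f) (0≤f x))) ∑≤0) y∈

  square-nonNeg : ∀ i → 0ℤ ≤ i * i
  square-nonNeg (+ n)    = subst (0ℤ ≤_) (ℤₚ.pos-* n n) (+≤+ ℕ.z≤n)
  square-nonNeg -[1+ n ] = +≤+ ℕ.z≤n

  square-zero : ∀ i → i * i ≡ 0ℤ → i ≡ 0ℤ
  square-zero i eq = [ id , id ]′ (ℤₚ.i*j≡0⇒i≡0∨j≡0 i eq)

  -- Double counting over the graph of `κ`. The fibre bound is demanded only where `u` does not
  -- vanish: in the application the fibre over the identity contains every pair `(t , 𝟎)` and may be
  -- larger than `k`, but has weight zero.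
  ∑-fibre-≤ : (_≟_ : DecidableEquality J) (κ : I → J) (xs : List I) {ys : List J} → Unique ys →
    (∀ {x} → x ∈ xs → κ x ∈ ys) → (u : J → ℤ) → (∀ y → 0ℤ ≤ u y) → (k : ℕ) →
    (∀ {y} → y ∈ ys → u y ≢ 0ℤ → length (filter (λ x → κ x ≟ y) xs) ℕ.≤ k) →
    ∑ xs (u ∘ κ) ≤ + k * ∑ ys u
  ∑-fibre-≤ _≟_ κ xs {ys} ys! κ∈ u 0≤u k fibre = begin
    ∑ xs (u ∘ κ)                       ≡⟨ ∑-cong xs (λ {x} x∈ → sym (single x∈)) ⟩
    ∑ xs (λ x → ∑ ys (λ y → δ x y))    ≡⟨ ∑-swap xs ys δ ⟩
    ∑ ys (λ y → ∑ xs (λ x → δ x y))    ≡⟨ ∑-cong-≗ ys (λ y → ∑-if (λ x → κ x ≟ y) xs (u y)) ⟩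
    ∑ ys (λ y → + length (filter (λ x → κ x ≟ y) xs) * u y)  ≤⟨ bound ys (λ y∈ → y∈) ⟩
    ∑ ys (λ y → + k * u y)             ≡⟨ *-∑ (+ k) ys u ⟨
    + k * ∑ ys u                       ∎
    where
    open ℤₚ.≤-Reasoning
    δ : _ → _ → ℤ
    δ x y = if does (κ x ≟ y) then u y else 0ℤ

    single : ∀ {x} → x ∈ xs → ∑ ys (δ x) ≡ u (κ x)
    single {x} x∈ = trans (∑-single ys! (κ∈ x∈) (δ x) (λ {y} _ → off y)) on
      where
      off : ∀ y → y ≢ κ x → δ x y ≡ 0ℤ
      off y y≢ with κ x ≟ y
      ... | yes eq = ⊥-elim (y≢ (sym eq))
      ... | no  _  = refl
      on : δ x (κ x) ≡ u (κ x)
      on with κ x ≟ κ x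
      ... | yes _ = refl
      ... | no ¬p = ⊥-elim (¬p refl)

    term : ∀ {y} → y ∈ ys → + length (filter (λ x → κ x ≟ y) xs) * u y ≤ + k * u y
    term {y} y∈ with u y ℤₚ.≟ 0ℤ
    ... | yes eq = ℤₚ.≤-reflexive (trans (*-u≡0 (+ length (filter (λ x → κ x ≟ y) xs))) (sym (*-u≡0 (+ k))))
      where
      *-u≡0 : ∀ c → c * u y ≡ 0ℤ
      *-u≡0 c = trans (cong (c *_) eq) (ℤₚ.*-zeroʳ c)
    ... | no  ne = ℤₚ.*-monoʳ-≤-nonNeg (u y) {{ℤ.nonNegative (0≤u y)}} (+≤+ (fibre y∈ ne))

    bound : ∀ zs → (∀ {z} → z ∈ zs → z ∈ ys) →
            ∑ zs (λ y → + length (filter (λ x → κ x ≟ y) xs) * u y) ≤ ∑ zs (λ y → + k * u y)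
    bound []       _ = ℤₚ.≤-refl
    bound (z ∷ zs) ⊆ = ℤₚ.+-mono-≤ (term (⊆ (here refl))) (bound zs (⊆ ∘ there))

-- Enumeration of vectors, and tables

abstract
  enumerate-Vec : ∀ {I : Set} → Enumeration I → ∀ n → Enumeration (Vec I n)
  enumerate-Vec E zero = record
    { elements = [] ∷ [] ; complete = λ { [] → here refl } ; unique = [] ∷ [] }
  enumerate-Vec {I} E (suc n) = record
    { elements = cartesianProductWith _∷_ (elements E) (elements En)
    ; complete = λ { (x ∷ xs) → ∈-cartesianProductWith⁺ _∷_ (complete E x) (complete En xs) }
    ; unique   = Uniqueₚ.cartesianProductWith⁺ _∷_ Vecₚ.∷-injective (unique E) (unique En)
    }
    where
    open Enumeration
    En : Enumeration (Vec I n)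
    En = enumerate-Vec E n

lookup-injective : {xs : List I} → Unique xs → ∀ i j → List.lookup xs i ≡ List.lookup xs j → i ≡ j
lookup-injective (x∉ ∷ xs!) Fin.zero    Fin.zero    eq = refl
lookup-injective (x∉ ∷ xs!) Fin.zero    (Fin.suc j) eq = ⊥-elim (All.lookup x∉ (∈-lookup j) eq)
lookup-injective (x∉ ∷ xs!) (Fin.suc i) Fin.zero    eq = ⊥-elim (All.lookup x∉ (∈-lookup i) (sym eq))
lookup-injective (x∉ ∷ xs!) (Fin.suc i) (Fin.suc j) eq = cong Fin.suc (lookup-injective xs! i j eq)

-- Tables replace functions so that pointwise equality becomes propositional.
module Tables (E : Enumeration I) where
  open Enumeration E

  Table : Set → Set
  Table J = Vec J (length elements)

  infixl 9 _$_
  abstract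
    _$_ : Table J → I → J
    t $ x = Vec.lookup t (Any.index (complete x))

    table : (I → J) → Table J
    table f = Vec.tabulate (f ∘ List.lookup elements)

    table-$ : (f : I → J) → ∀ x → table f $ x ≡ f x
    table-$ f x = trans (Vecₚ.lookup∘tabulate (f ∘ List.lookup elements) _) (cong f (sym (Anyₚ.lookup-index (complete x))))

    $-injective : ∀ {J : Set} {s t : Table J} → (∀ x → s $ x ≡ t $ x) → s ≡ t
    $-injective {J} {s} {t} eq = trans (sym (η s)) (trans (Vecₚ.tabulate-cong (eq ∘ List.lookup elements)) (η t))
      where
      η : (t : Table J) → table (t $_) ≡ t
      η t = trans (Vecₚ.tabulate-cong λ i → cong (Vec.lookup t)
              (lookup-injective unique _ i (sym (Anyₚ.lookup-index (complete (List.lookup elements i))))))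
            (Vecₚ.tabulate∘lookup t)

  table-unique : {t : Table J} {f : I → J} → (∀ x → f x ≡ t $ x) → table f ≡ t
  table-unique eq = $-injective λ x → trans (table-$ _ x) (eq x)

-- Ring solver with integer coefficients

module RingSolver {c ℓ} (R : CommutativeRing c ℓ) where
  open CommutativeRing R renaming (refl to ≈-refl; sym to ≈-sym; trans to ≈-trans)
  open Algebra.Properties.Ring ring
  open Algebra.Properties.AbelianGroup +-abelianGroup using (⁻¹-∙-comm)
  open Algebra.Properties.Semiring.Mult semiring renaming (_×_ to _×′_)
  open import Relation.Binary.Reasoning.Setoid setoid

  -- Coefficients are taken from ℤ, where 1 + (-1) computes to 0 and equality is decided; in the
  -- abstract ring neither is available. This is the canonical homomorphism out of ℤ.
  fromℤ : ℤ → Carrier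
  fromℤ (+ n)      = n ×′ 1#
  fromℤ (-[1+ n ]) = - (suc n ×′ 1#)

  private
    ⊖-homo : ∀ m n → fromℤ (m ℤ.⊖ n) ≈ m ×′ 1# + - (n ×′ 1#)
    ⊖-homo zero    zero    = ≈-sym (-‿inverseʳ 0#)
    ⊖-homo zero    (suc n) = ≈-sym (+-identityˡ _)
    ⊖-homo (suc m) zero    = ≈-sym (≈-trans (+-congˡ -0#≈0#) (+-identityʳ _))
    ⊖-homo (suc m) (suc n) = begin
      fromℤ (suc m ℤ.⊖ suc n)                  ≡⟨ cong fromℤ (ℤₚ.[1+m]⊖[1+n]≡m⊖n m n) ⟩
      fromℤ (m ℤ.⊖ n)                          ≈⟨ ⊖-homo m n ⟩
      x + - y                              ≈⟨ +-congʳ (≈-trans (≈-sym (+-identityʳ x)) (+-congˡ (≈-sym (-‿inverseʳ 1#)))) ⟩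
      (x + (1# + - 1#)) + - y              ≈⟨ +-congʳ (≈-trans (≈-sym (+-assoc x 1# _)) (+-congʳ (+-comm x 1#))) ⟩
      ((1# + x) + - 1#) + - y              ≈⟨ +-assoc _ _ _ ⟩
      (1# + x) + (- 1# + - y)              ≈⟨ +-congˡ (⁻¹-∙-comm 1# y) ⟩
      (1# + x) + - (1# + y)                ∎
      where x = m ×′ 1# ; y = n ×′ 1#

    +-homo : ∀ i j → fromℤ (i ℤ.+ j) ≈ fromℤ (i) + fromℤ (j)
    +-homo (+ m)      (+ n)      = ×-homo-+ 1# m n
    +-homo (+ m)      -[1+ n ]   = ⊖-homo m (suc n)
    +-homo -[1+ m ]   (+ n)      = ≈-trans (⊖-homo n (suc m)) (+-comm _ _)
    +-homo -[1+ m ]   -[1+ n ]   = ≈-trans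
      (-‿cong (≈-trans (+-congˡ (×-homo-+ 1# (suc m) n)) (≈-trans (≈-sym (+-assoc _ _ _))
        (≈-trans (+-congʳ (+-comm _ _)) (+-assoc _ _ _)))))
      (≈-sym (⁻¹-∙-comm _ _))

    +◃-homo : ∀ n → fromℤ (Sign.+ ℤ.◃ n) ≈ n ×′ 1#
    +◃-homo zero    = ≈-refl
    +◃-homo (suc n) = ≈-refl

    -◃-homo : ∀ n → fromℤ (Sign.- ℤ.◃ n) ≈ - (n ×′ 1#)
    -◃-homo zero    = ≈-sym -0#≈0#
    -◃-homo (suc n) = ≈-refl

    *-homo : ∀ i j → fromℤ (i ℤ.* j) ≈ fromℤ (i) * fromℤ (j)
    *-homo (+ m)    (+ n)    = ≈-trans (+◃-homo (m ℕ.* n)) (×1-homo-* m n)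
    *-homo (+ m)    -[1+ n ] = ≈-trans (-◃-homo (m ℕ.* suc n))
      (≈-trans (-‿cong (×1-homo-* m (suc n))) (-‿distribʳ-* _ _))
    *-homo -[1+ m ] (+ n)    = ≈-trans (-◃-homo (suc m ℕ.* n))
      (≈-trans (-‿cong (×1-homo-* (suc m) n)) (-‿distribˡ-* _ _))
    *-homo -[1+ m ] -[1+ n ] = ≈-trans (+◃-homo (suc m ℕ.* suc n))
      (≈-trans (×1-homo-* (suc m) (suc n)) (≈-sym (≈-trans (≈-sym (-‿distribˡ-* _ _))
        (≈-trans (-‿cong (≈-sym (-‿distribʳ-* _ _))) (-‿involutive _)))))

    neg-homo : ∀ i → fromℤ (ℤ.- i) ≈ - fromℤ (i)
    neg-homo (+ zero)  = ≈-sym -0#≈0#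
    neg-homo (+ suc n) = ≈-refl
    neg-homo -[1+ n ]  = ≈-sym (-‿involutive _)

    morphism : CommutativeRing.rawRing ℤₚ.+-*-commutativeRing -Raw-AlmostCommutative⟶ fromCommutativeRing R
    morphism = record
      { ⟦_⟧    = fromℤ
      ; +-homo = +-homo
      ; *-homo = *-homo
      ; -‿homo = neg-homo
      ; 0-homo = ≈-refl
      ; 1-homo = +-identityʳ 1#
      }

  open Algebra.Solver.Ring (CommutativeRing.rawRing ℤₚ.+-*-commutativeRing) (fromCommutativeRing R) morphism
    (λ i j → Maybe.map (λ eq → reflexive (cong fromℤ eq)) (dec⇒weaklyDec ℤₚ._≟_ i j)) public

-- Vectors form a ring under pointwise multiplication; this serves only to
-- make the ring solver available for identities in the additive group.
module VectorRing {A : Set} {_+_ _*_ : A → A → A} { -_ : A → A} {0# 1# : A}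
  (isCommutativeRing : IsCommutativeRing _≡_ _+_ _*_ -_ 0# 1#) (n : ℕ) where
  open IsCommutativeRing isCommutativeRing
    using (+-assoc; +-comm; +-identityˡ; +-identityʳ; -‿inverseˡ; -‿inverseʳ;
           *-assoc; *-comm; *-identityˡ; *-identityʳ; distribˡ; distribʳ)

  vectorRing : CommutativeRing 0ℓ 0ℓ
  vectorRing = record
    { Carrier = Vec A n
    ; _≈_ = _≡_
    ; _+_ = Vec.zipWith _+_
    ; _*_ = Vec.zipWith _*_
    ; -_  = Vec.map -_
    ; 0#  = Vec.replicate n 0#
    ; 1#  = Vec.replicate n 1#
    ; isCommutativeRing = record
      { isRing = record
        { +-isAbelianGroup = record
          { isGroup = record
            { isMonoid = record
              { isSemigroup = record
                { isMagma = ≡.isMagma _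
                ; assoc = Vecₚ.zipWith-assoc +-assoc
                }
              ; identity = Vecₚ.zipWith-identityˡ +-identityˡ , Vecₚ.zipWith-identityʳ +-identityʳ
              }
            ; inverse = Vecₚ.zipWith-inverseˡ -‿inverseˡ , Vecₚ.zipWith-inverseʳ -‿inverseʳ
            ; ⁻¹-cong = ≡.cong _
            }
          ; comm = Vecₚ.zipWith-comm +-comm
          }
        ; *-cong = ≡.cong₂ _
        ; *-assoc = Vecₚ.zipWith-assoc *-assoc
        ; *-identity = Vecₚ.zipWith-identityˡ *-identityˡ , Vecₚ.zipWith-identityʳ *-identityʳ
        ; distrib = Vecₚ.zipWith-distribˡ distribˡ , Vecₚ.zipWith-distribʳ distribʳ
        }
      ; *-comm = Vecₚ.zipWith-comm *-comm
      }
    }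

-- Finite fields and their characteristic

least : {P : ℕ → Set} → Decidable P → ∀ m → P m → ∃ λ k → P k × (∀ i → i ℕ.< k → ¬ P i)
least {P} P? m Pm = go m 0 (λ _ ()) (subst P (sym (ℕₚ.+-identityʳ m)) Pm)
  where
  go : ∀ m k → (∀ i → i ℕ.< k → ¬ P i) → P (m ℕ.+ k) → ∃ λ k → P k × (∀ i → i ℕ.< k → ¬ P i)
  go zero    k below Pk = k , Pk , below
  go (suc m) k below P+ with P? k
  ... | yes Pk = k , Pk , below
  ... | no ¬Pk = go m (suc k) below′ (subst P (sym (ℕₚ.+-suc m k)) P+)
    where
    below′ : ∀ i → i ℕ.< suc k → ¬ P i
    below′ i i<1+k with ℕₚ.m≤n⇒m<n∨m≡n (ℕₚ.≤-pred i<1+k)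
    ... | inj₁ i<k  = below i i<k
    ... | inj₂ refl = ¬Pk

module Field (F : FiniteField) where
  open FiniteField F public
    using (Carrier; 0#; 1#; 0≢1; inverse; _≟_; isCommutativeRing)
  module F′ = FiniteField F

  fieldRing : CommutativeRing 0ℓ 0ℓ
  fieldRing = record { isCommutativeRing = isCommutativeRing }

  open CommutativeRing fieldRing public
    using (_+_; _*_; -_; +-assoc; +-comm; +-identityˡ; +-identityʳ;
           -‿inverseʳ; *-assoc; *-comm; *-identityˡ; *-identityʳ; zeroˡ; zeroʳ; semiring; +-isCommutativeMonoid)
  module FS = RingSolver fieldRing

  enumerate-field : Enumeration Carrier
  enumerate-field = record
    { elements = map to (allFin _)
    ; complete = λ x → subst (_∈ _) (strictlyInverseˡ x) (∈-map⁺ to (∈-allFin (from x)))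
    ; unique   = Uniqueₚ.map⁺ (λ {i} {j} eq → trans (sym (strictlyInverseʳ i)) (trans (cong from eq) (strictlyInverseʳ j)))
                              (Uniqueₚ.allFin⁺ _)
    }
    where open Inverse F′.enum

  infix 9 _⁻¹⟨_⟩
  _⁻¹⟨_⟩ : ∀ c → c ≢ 0# → Carrier
  c ⁻¹⟨ c≢0 ⟩ = proj₁ (inverse c c≢0)

  *-inverseʳ : ∀ {c} (c≢0 : c ≢ 0#) → c * c ⁻¹⟨ c≢0 ⟩ ≡ 1#
  *-inverseʳ c≢0 = proj₂ (inverse _ c≢0)

  *-inverseˡ : ∀ {c} (c≢0 : c ≢ 0#) → c ⁻¹⟨ c≢0 ⟩ * c ≡ 1#
  *-inverseˡ c≢0 = trans (*-comm _ _) (*-inverseʳ c≢0)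

  ⁻¹-≢0 : ∀ {c} (c≢0 : c ≢ 0#) → c ⁻¹⟨ c≢0 ⟩ ≢ 0#
  ⁻¹-≢0 c≢0 eq = 0≢1 (trans (sym (zeroʳ _)) (trans (cong (_ *_) (sym eq)) (*-inverseʳ c≢0)))

  *-zero-divisor : ∀ {c d} → c * d ≡ 0# → c ≢ 0# → d ≡ 0#
  *-zero-divisor {c} {d} cd≡0 c≢0 = begin
    d                    ≡⟨ *-identityˡ d ⟨
    1# * d               ≡⟨ cong (_* d) (*-inverseˡ c≢0) ⟨
    c ⁻¹⟨ c≢0 ⟩ * c * d  ≡⟨ *-assoc _ c d ⟩
    c ⁻¹⟨ c≢0 ⟩ * (c * d) ≡⟨ cong (_ *_) cd≡0 ⟩
    c ⁻¹⟨ c≢0 ⟩ * 0#     ≡⟨ zeroʳ _ ⟩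
    0#                   ∎
    where open ≡-Reasoning

  +-cancel : ∀ {a b} → a + - b ≡ 0# → a ≡ b
  +-cancel {a} {b} eq = trans (solve 2 (λ a b → a := (a :+ :- b) :+ b) refl a b)
                              (trans (cong (_+ b) eq) (+-identityˡ b))
    where open FS

  module Mult = Algebra.Properties.Semiring.Mult semiring

  ι : ℕ → Carrier
  ι k = k Mult.× 1#

  ι-+ : ∀ m n → ι (m ℕ.+ n) ≡ ι m + ι n
  ι-+ = Mult.×-homo-+ 1#

  ι-* : ∀ m n → ι (m ℕ.* n) ≡ ι m * ι n
  ι-* = Mult.×1-homo-*

  -- Translating by 1# permutes the field, so its elements sum to themselves plus |F| · 1#.
  ι-card≡0 : ι (length (Enumeration.elements enumerate-field)) ≡ 0#
  ι-card≡0 = begin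
    ι (length Fs)             ≡⟨ ∑-1 Fs ⟨
    ∑ Fs (λ _ → 1#)           ≡⟨ solve 2 (λ a b → b := (a :+ b) :+ :- a) refl (∑ Fs id) _ ⟩
    (∑ Fs id + ∑ Fs (λ _ → 1#)) + - ∑ Fs id  ≡⟨ cong (_+ - ∑ Fs id) (∑-distrib Fs id _) ⟨
    ∑ Fs (_+ 1#) + - ∑ Fs id  ≡⟨ cong (_+ - ∑ Fs id) shift ⟩
    ∑ Fs id + - ∑ Fs id       ≡⟨ -‿inverseʳ _ ⟩
    0#                        ∎
    where
    open ≡-Reasoning
    open FS using (solve; _:=_; _:+_; :-_)
    open Summation +-isCommutativeMonoid
    open Enumeration enumerate-field renaming (elements to Fs)
    ∑-1 : ∀ xs → ∑ {I = Carrier} xs (λ _ → 1#) ≡ ι (length xs)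
    ∑-1 []       = refl
    ∑-1 (x ∷ xs) = cong (λ c → 1# + c) (∑-1 xs)
    shift : ∑ Fs (_+ 1#) ≡ ∑ Fs id
    shift = ∑-reindex unique (_+ 1#) (_+ - 1#) (λ _ → complete _) (λ _ → complete _)
      (λ {x} _ → solve 2 (λ x o → (x :+ :- o) :+ o := x) refl x 1#)
      (λ {x} _ → solve 2 (λ x o → (x :+ o) :+ :- o := x) refl x 1#) id

  private
    -- The order of the field bounds the search, by `ι-card≡0`. Indexing by `suc k` excludes the
    -- trivial multiple 0. Minimality is all that is recorded; it stands in for primality later.
    characteristic : ∃ λ k → ι (suc k) ≡ 0# × (∀ i → i ℕ.< k → ι (suc i) ≢ 0#)
    characteristic = least (λ k → ι (suc k) ≟ 0#) (ℕ.pred card)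
      (subst (λ k → ι k ≡ 0#) (sym (ℕₚ.suc-pred card {{card≢0}})) ι-card≡0)
      where
      card = length (Enumeration.elements enumerate-field)
      card≢0 = ℕ.>-nonZero (∈-length (Enumeration.complete enumerate-field 0#))

  abstract
    p : ℕ
    p = suc (proj₁ characteristic)

    0<p : 0 ℕ.< p
    0<p = ℕ.s≤s ℕ.z≤n

    ι-p : ι p ≡ 0#
    ι-p = proj₁ (proj₂ characteristic)

    ι-≢0 : ∀ {i} → i ≢ 0 → i ℕ.< p → ι i ≢ 0#
    ι-≢0 {zero}  i≢0 _   = ⊥-elim (i≢0 refl)
    ι-≢0 {suc i} _   i<p = proj₂ (proj₂ characteristic) i (ℕₚ.≤-pred i<p)

  ι-∸ : ∀ {i j} → i ℕ.≤ j → ι (j ℕ.∸ i) ≡ ι j + - ι i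
  ι-∸ {i} {j} i≤j = begin
    ι (j ℕ.∸ i)                  ≡⟨ solve 2 (λ d i → d := (d :+ i) :+ :- i) refl _ (ι i) ⟩
    (ι (j ℕ.∸ i) + ι i) + - ι i  ≡⟨ cong (_+ - ι i) (ι-+ (j ℕ.∸ i) i) ⟨
    ι (j ℕ.∸ i ℕ.+ i) + - ι i    ≡⟨ cong (λ k → ι k + - ι i) (ℕₚ.m∸n+n≡m i≤j) ⟩
    ι j + - ι i                  ∎
    where
    open ≡-Reasoning
    open FS using (solve; _:=_; _:+_; :-_)

  ι-injective-≤ : ∀ {i j} → i ℕ.≤ j → j ℕ.< p → ι i ≡ ι j → i ≡ j
  ι-injective-≤ {i} {j} i≤j j<p eq with j ℕ.∸ i ℕₚ.≟ 0
  ... | yes d≡0 = ℕₚ.≤-antisym i≤j (ℕₚ.m∸n≡0⇒m≤n d≡0)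
  ... | no  d≢0 = ⊥-elim (ι-≢0 d≢0 (ℕₚ.≤-<-trans (ℕₚ.m∸n≤m j i) j<p)
                    (trans (ι-∸ i≤j) (trans (cong (λ c → ι j + - c) eq) (-‿inverseʳ _))))

  -- Subtraction modulo `p` on the residues 0 to `p` - 1: a negative difference is raised by `p`,
  -- which `ι` sends to `0#`.
  ι-difference : ∀ {i j} → i ℕ.< p → j ℕ.< p → ∃ λ d → d ℕ.< p × ι d ≡ ι j + - ι i
  ι-difference {i} {j} i<p j<p with ℕₚ.≤-total i j
  ... | inj₁ i≤j = j ℕ.∸ i , ℕₚ.≤-<-trans (ℕₚ.m∸n≤m j i) j<p , ι-∸ i≤j
  ... | inj₂ j≤i with ℕₚ.m≤n⇒m<n∨m≡n j≤i
  -- Equality is kept apart from the last case, whose witness would here be `p` itself and so out of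
  -- range.
  ...   | inj₂ refl = 0 , 0<p , sym (-‿inverseʳ (ι i))
  ...   | inj₁ j<i  = p ℕ.∸ (i ℕ.∸ j) , ℕₚ.∸-monoʳ-< (ℕₚ.m<n⇒0<n∸m j<i) i∸j≤p , (begin
    ι d                        ≡⟨ solve 3 (λ d e j → d := (d :+ e) :+ (j :+ :- (e :+ j))) refl _ (ι e) (ι j) ⟩
    (ι d + ι e) + (ι j + - (ι e + ι j))  ≡⟨ cong₂ (λ s t → s + (ι j + - t)) (ι-+ d e) (ι-+ e j) ⟨
    ι (d ℕ.+ e) + (ι j + - ι (e ℕ.+ j))  ≡⟨ cong₂ (λ k l → ι k + (ι j + - ι l)) (ℕₚ.m∸n+n≡m i∸j≤p) (ℕₚ.m∸n+n≡m j≤i) ⟩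
    ι p + (ι j + - ι i)        ≡⟨ cong (_+ (ι j + - ι i)) ι-p ⟩
    0# + (ι j + - ι i)         ≡⟨ +-identityˡ _ ⟩
    ι j + - ι i                ∎)
    where
    open ≡-Reasoning
    open FS using (solve; _:=_; _:+_; :-_)
    e = i ℕ.∸ j
    d = p ℕ.∸ e
    i∸j≤p : e ℕ.≤ p
    i∸j≤p = ℕₚ.≤-trans (ℕₚ.m∸n≤m i j) (ℕₚ.<⇒≤ i<p)

  ι-injective : ∀ {i j} → i ℕ.< p → j ℕ.< p → ι i ≡ ι j → i ≡ j
  ι-injective {i} {j} i<p j<p eq with ℕₚ.≤-total i j
  ... | inj₁ i≤j = ι-injective-≤ i≤j j<p eq
  ... | inj₂ j≤i = sym (ι-injective-≤ j≤i i<p (sym eq))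

-- The vector space and its additive subgroups

module Space (F : FiniteField) (n : ℕ) where
  open Field F public
  open VectorRing isCommutativeRing n public
  module VS = RingSolver vectorRing

  infixl 6 _✚_ _─_
  infixr 8 _∙_
  Vect : Set
  Vect = V F n

  _✚_ _─_ : Vect → Vect → Vect
  _✚_ = _⊕_ F
  _─_ = _⊖_ F

  _∙_ : Carrier → Vect → Vect
  _∙_ = _·_ F

  𝟎 : Vect
  𝟎 = Vec.replicate n 0#

  open CommutativeRing vectorRing public
    using () renaming (+-identityˡ to ✚-identityˡ; +-identityʳ to ✚-identityʳ; +-comm to ✚-comm; +-assoc to ✚-assoc;
                       -‿inverseʳ to ─-self)
  open VS using (solve; _:=_; _:+_; :-_; _:*_; _:-_)

  private
    scalar : Carrier → Vect
    scalar = Vec.replicate n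

    -- Scalars become constant vectors, so that the laws of `∙` are identities of the pointwise
    -- ring.
    ∙-scalar : ∀ c x → c ∙ x ≡ Vec.zipWith _*_ (scalar c) x
    ∙-scalar c x = sym (Vecₚ.zipWith-replicate₁ _*_ c x)

  ∙-distrib-─ : ∀ c x y → c ∙ (x ─ y) ≡ c ∙ x ─ c ∙ y
  ∙-distrib-─ c x y rewrite ∙-scalar c (x ─ y) | ∙-scalar c x | ∙-scalar c y =
    solve 3 (λ c x y → c :* (x :- y) := c :* x :- c :* y) refl (scalar c) x y

  +-distrib-∙ : ∀ c d x → (c + d) ∙ x ≡ c ∙ x ✚ d ∙ x
  +-distrib-∙ c d x rewrite ∙-scalar (c + d) x | ∙-scalar c x | ∙-scalar d x
    | sym (Vecₚ.zipWith-replicate {n = n} _+_ c d) =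
    solve 3 (λ c d x → (c :+ d) :* x := c :* x :+ d :* x) refl (scalar c) (scalar d) x

  -‿distrib-∙ : ∀ c d x → (c + - d) ∙ x ≡ c ∙ x ─ d ∙ x
  -‿distrib-∙ c d x rewrite ∙-scalar (c + - d) x | ∙-scalar c x | ∙-scalar d x
    | sym (Vecₚ.zipWith-replicate {n = n} _+_ c (- d)) | sym (Vecₚ.map-replicate -_ d n) =
    solve 3 (λ c d x → (c :+ :- d) :* x := c :* x :- d :* x) refl (scalar c) (scalar d) x

  ∙-assoc : ∀ c d x → (c * d) ∙ x ≡ c ∙ (d ∙ x)
  ∙-assoc c d x rewrite ∙-scalar (c * d) x | ∙-scalar d x | ∙-scalar c (Vec.zipWith _*_ (scalar d) x)
    | sym (Vecₚ.zipWith-replicate {n = n} _*_ c d) =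
    solve 3 (λ c d x → (c :* d) :* x := c :* (d :* x)) refl (scalar c) (scalar d) x

  1∙ : ∀ x → 1# ∙ x ≡ x
  1∙ x = trans (∙-scalar 1# x) (CommutativeRing.*-identityˡ vectorRing x)

  0∙ : ∀ x → 0# ∙ x ≡ 𝟎
  0∙ x = trans (∙-scalar 0# x) (CommutativeRing.zeroˡ vectorRing x)

  ∙𝟎 : ∀ c → c ∙ 𝟎 ≡ 𝟎
  ∙𝟎 c = trans (∙-scalar c 𝟎) (CommutativeRing.zeroʳ vectorRing (scalar c))

  ─-cancel : ∀ {x y} → x ─ y ≡ 𝟎 → x ≡ y
  ─-cancel {x} {y} eq = trans (solve 2 (λ x y → x := (x :- y) :+ y) refl x y)
    (trans (cong (_✚ y) eq) (✚-identityˡ y))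

  ✚-cancelʳ : ∀ z {x y} → x ✚ z ≡ y ✚ z → x ≡ y
  ✚-cancelʳ z {x} {y} eq = trans (sym (un x)) (trans (cong (_─ z) eq) (un y))
    where
    un : ∀ x → x ✚ z ─ z ≡ x
    un x = solve 2 (λ x z → (x :+ z) :- z := x) refl x z

  ✚-cancelˡ : ∀ z {x y} → z ✚ x ≡ z ✚ y → x ≡ y
  ✚-cancelˡ z eq = ✚-cancelʳ z (trans (✚-comm _ z) (trans eq (✚-comm z _)))

  ∙-inverse : ∀ {c} (c≢0 : c ≢ 0#) x → c ∙ (c ⁻¹⟨ c≢0 ⟩ ∙ x) ≡ x
  ∙-inverse c≢0 x = trans (sym (∙-assoc _ _ x)) (trans (cong (_∙ x) (*-inverseʳ c≢0)) (1∙ x))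

  ∙-inverse′ : ∀ {c} (c≢0 : c ≢ 0#) x → c ⁻¹⟨ c≢0 ⟩ ∙ (c ∙ x) ≡ x
  ∙-inverse′ c≢0 x = trans (sym (∙-assoc _ _ x)) (trans (cong (_∙ x) (*-inverseˡ c≢0)) (1∙ x))

  ∙≡𝟎 : ∀ {c x} → c ∙ x ≡ 𝟎 → c ≢ 0# → x ≡ 𝟎
  ∙≡𝟎 {c} {x} eq c≢0 = trans (sym (∙-inverse′ c≢0 x)) (trans (cong (_ ∙_) eq) (∙𝟎 _))

  ∙-cancelʳ : ∀ {c d x} → x ≢ 𝟎 → c ∙ x ≡ d ∙ x → c ≡ d
  ∙-cancelʳ {c} {d} {x} x≢𝟎 eq with c ≟ d
  ... | yes c≡d = c≡d
  ... | no  c≢d = ⊥-elim (x≢𝟎 (∙≡𝟎 (trans (-‿distrib-∙ c d x) (trans (cong (_─ d ∙ x) eq) (─-self _)))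
                                    (c≢d ∘ +-cancel)))

  ─-𝟎 : ∀ x → x ─ 𝟎 ≡ x
  ─-𝟎 x = ✚-cancelʳ 𝟎 (trans (solve 2 (λ x o → x :- o :+ o := x) refl x 𝟎) (sym (✚-identityʳ x)))

  _≟ᵥ_ : DecidableEquality Vect
  _≟ᵥ_ = Vecₚ.≡-dec _≟_

  enumerate-space : Enumeration Vect
  enumerate-space = enumerate-Vec enumerate-field n

  record IsSubgroup (Z : Vect → Set) : Set where
    field
      𝟎-closed : Z 𝟎
      ✚-closed : ∀ {x y} → Z x → Z y → Z (x ✚ y)
      ─-closed : ∀ {x} → Z x → Z (𝟎 ─ x)

    ι-closed : ∀ k {x} → Z x → Z (ι k ∙ x)
    ι-closed zero    Zx = subst Z (sym (0∙ _)) 𝟎-closed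
    ι-closed (suc k) Zx = subst Z (sym (+-distrib-∙ 1# (ι k) _))
      (✚-closed (subst Z (sym (1∙ _)) Zx) (ι-closed k Zx))

    -- Euclid's algorithm on the pair (p , i); p is minimal, so it has no proper divisor.
    ι-faithful : ∀ {h} → ¬ Z h → ∀ i → i ≢ 0 → i ℕ.< p → ¬ Z (ι i ∙ h)
    ι-faithful {h} ¬Zh = ℕᵢ.<-rec _ step
      where
      step : ∀ i → (∀ {j} → j ℕ.< i → j ≢ 0 → j ℕ.< p → ¬ Z (ι j ∙ h)) →
             i ≢ 0 → i ℕ.< p → ¬ Z (ι i ∙ h)
      step zero rec i≢0 _ _ = i≢0 refl
      step 1 rec _ _ Zh = ¬Zh (subst Z (trans (cong (_∙ h) (+-identityʳ 1#)) (1∙ h)) Zh)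
      step i@(suc (suc _)) rec i≢0 i<p Zih with p DivMod.% i ℕₚ.≟ 0
      ... | no r≢0 = rec (DivMod.m%n<n p i) r≢0 (ℕₚ.<-trans (DivMod.m%n<n p i) i<p)
            (subst Z rh (─-closed (ι-closed (p DivMod./ i) Zih)))
        where
        open ≡-Reasoning
        r = p DivMod.% i
        k = p DivMod./ i
        rh : 𝟎 ─ ι k ∙ (ι i ∙ h) ≡ ι r ∙ h
        rh = begin
          𝟎 ─ ι k ∙ (ι i ∙ h)              ≡⟨ cong₂ _─_ (0∙ h) (∙-assoc (ι k) (ι i) h) ⟨
          0# ∙ h ─ (ι k * ι i) ∙ h         ≡⟨ -‿distrib-∙ _ _ h ⟨
          (0# + - (ι k * ι i)) ∙ h         ≡⟨ cong (_∙ h) (begin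
            0# + - (ι k * ι i)                   ≡⟨ cong₂ (λ a b → a + - b) (sym ι-p) (sym (ι-* k i)) ⟩
            ι p + - ι (k ℕ.* i)                  ≡⟨ cong (λ m → ι m + - ι (k ℕ.* i)) (DivMod.m≡m%n+[m/n]*n p i) ⟩
            ι (r ℕ.+ k ℕ.* i) + - ι (k ℕ.* i)    ≡⟨ cong (_+ - ι (k ℕ.* i)) (ι-+ r (k ℕ.* i)) ⟩
            ι r + ι (k ℕ.* i) + - ι (k ℕ.* i)    ≡⟨ FS.solve 2 (λ a b → a FS.:+ b FS.:+ FS.:- b FS.:= a) refl (ι r) _ ⟩
            ι r                                  ∎) ⟩
          ι r ∙ h                          ∎
      ... | yes r≡0 = ι-≢0 {k} k≢0 (DivMod.m/n<m p i {{ℕ.>-nonZero 0<p}} (ℕ.s≤s (ℕ.s≤s ℕ.z≤n)))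
            (*-zero-divisor (trans (*-comm (ι i) (ι k)) (trans (sym (ι-* k i)) (trans (cong ι (sym p≡ki)) ι-p))) (ι-≢0 i≢0 i<p))
        where
        k = p DivMod./ i
        p≡ki : p ≡ k ℕ.* i
        p≡ki = trans (DivMod.m≡m%n+[m/n]*n p i) (cong (ℕ._+ k ℕ.* i) r≡0)
        k≢0 : k ≢ 0
        k≢0 k≡0 = ℕₚ.<-irrefl (sym (trans p≡ki (cong (ℕ._* i) k≡0))) 0<p

-- Automorphisms of the Cayley graph and conjugation of translations

≡true⇒≡ : ∀ {a b} → (a ≡ true → b ≡ true) → (b ≡ true → a ≡ true) → a ≡ b
≡true⇒≡ {true}  {true}  f g = refl
≡true⇒≡ {true}  {false} f g = sym (f refl)
≡true⇒≡ {false} {true}  f g = g refl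
≡true⇒≡ {false} {false} f g = refl

module Graph (F : FiniteField) (n : ℕ) (S : V F n → Bool) (K≤Aut : KLeAut F S) where
  open Space F n public
  open Tables enumerate-space public
  open VS using (solve; _:=_; _:+_; :-_; _:-_)
  module 𝕍 = Enumeration enumerate-space
  module 𝕋 = Enumeration (enumerate-Vec enumerate-space (length 𝕍.elements))

  _≟ₜ_ : DecidableEquality (Table Vect)
  _≟ₜ_ = Vecₚ.≡-dec _≟ᵥ_
    where import Data.Vec.Properties as Vecₚ

  record Aut (f : Vect → Vect) : Set where
    field
      f⁻¹      : Vect → Vect
      inverseˡ : ∀ x → f⁻¹ (f x) ≡ x
      inverseʳ : ∀ x → f (f⁻¹ x) ≡ x
      adjacent : ∀ u v → S (u ─ v) ≡ S (f u ─ f v)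

    injective : ∀ {x y} → f x ≡ f y → x ≡ y
    injective eq = trans (sym (inverseˡ _)) (trans (cong f⁻¹ eq) (inverseˡ _))

  open Aut

  Aut-≗ : ∀ {f g} → (∀ x → f x ≡ g x) → Aut f → Aut g
  Aut-≗ f≗g a = record
    { f⁻¹      = f⁻¹ a
    ; inverseˡ = λ x → trans (cong (f⁻¹ a) (sym (f≗g x))) (inverseˡ a x)
    ; inverseʳ = λ x → trans (sym (f≗g _)) (inverseʳ a x)
    ; adjacent = λ u v → trans (adjacent a u v) (cong₂ (λ x y → S (x ─ y)) (f≗g u) (f≗g v))
    }

  Aut-∘ : ∀ {f g} → Aut f → Aut g → Aut (f ∘ g)
  Aut-∘ {f} {g} a b = record
    { f⁻¹      = f⁻¹ b ∘ f⁻¹ a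
    ; inverseˡ = λ x → trans (cong (f⁻¹ b) (inverseˡ a (g x))) (inverseˡ b x)
    ; inverseʳ = λ x → trans (cong f (inverseʳ b (f⁻¹ a x))) (inverseʳ a x)
    ; adjacent = λ u v → trans (adjacent b u v) (adjacent a (g u) (g v))
    }

  Aut-⁻¹ : ∀ {f} (a : Aut f) → Aut (f⁻¹ a)
  Aut-⁻¹ {f} a = record
    { f⁻¹      = f
    ; inverseˡ = inverseʳ a
    ; inverseʳ = inverseˡ a
    ; adjacent = λ u v → sym (trans (adjacent a _ _)
        (cong₂ (λ x y → S (x ─ y)) (inverseʳ a u) (inverseʳ a v)))
    }

  -- The one place where K ≤ Aut(Γ) enters; all translations and scalings below come from here.
  Aut-affine : ∀ {c} → c ≢ 0# → ∀ b → Aut (λ x → c ∙ x ✚ b)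
  Aut-affine {c} c≢0 b = record
    { f⁻¹      = λ x → c ⁻¹⟨ c≢0 ⟩ ∙ (x ─ b)
    ; inverseˡ = λ x → trans (cong (_ ∙_) (solve 2 (λ x b → (x :+ b) :- b := x) refl (c ∙ x) b))
                             (∙-inverse′ c≢0 x)
    ; inverseʳ = λ x → trans (cong (_✚ b) (∙-inverse c≢0 (x ─ b)))
                             (solve 2 (λ x b → (x :- b) :+ b := x) refl x b)
    ; adjacent = λ u v → let iff = K≤Aut c c≢0 b u v in ≡true⇒≡ (Equivalence.to iff) (Equivalence.from iff)
    }

  Aut-✚ : ∀ b → Aut (_✚ b)
  Aut-✚ b = Aut-≗ (λ x → cong (_✚ b) (1∙ x)) (Aut-affine (0≢1 ∘ sym) b)

  Aut-─ : ∀ b → Aut (_─ b)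
  Aut-─ b = Aut-✚ (⊖_ F b)

  Aut-∙ : ∀ {c} → c ≢ 0# → Aut (c ∙_)
  Aut-∙ c≢0 = Aut-≗ (λ x → ✚-identityʳ _) (Aut-affine c≢0 𝟎)

  -- The inverse is itself a table, so that being an automorphism becomes an existence statement
  -- over a finite set and can be decided by search.
  Aut-witness : Table Vect → Set
  Aut-witness t = Σ (Table Vect) λ s → (∀ x → s $ (t $ x) ≡ x) × (∀ x → t $ (s $ x) ≡ x)
                  × (∀ u v → S (u ─ v) ≡ S (t $ u ─ t $ v))

  witness⇒Aut : ∀ {t} → Aut-witness t → Aut (t $_)
  witness⇒Aut (s , l , r , adj) = record { f⁻¹ = s $_ ; inverseˡ = l ; inverseʳ = r ; adjacent = adj }

  Aut⇒witness : ∀ {t} → Aut (t $_) → Aut-witness t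
  Aut⇒witness {t} a = table (f⁻¹ a) , (λ x → trans (table-$ (f⁻¹ a) (t $ x)) (inverseˡ a x)) ,
    (λ x → trans (cong (t $_) (table-$ (f⁻¹ a) x)) (inverseʳ a x)) , adjacent a

  abstract
    Aut? : Decidable (λ (t : Table Vect) → Aut (t $_))
    Aut? t = map′ witness⇒Aut Aut⇒witness (𝕋.any? λ s →
      𝕍.all? (λ x → (s $ (t $ x)) ≟ᵥ x) ×-dec 𝕍.all? (λ x → (t $ (s $ x)) ≟ᵥ x)
      ×-dec 𝕍.all? (λ u → 𝕍.all? λ v → S (u ─ v) Boolₚ.≟ S (t $ u ─ t $ v)))

  Aut-table : ∀ {f} → Aut f → Aut (table f $_)
  Aut-table = Aut-≗ λ x → sym (table-$ _ x)

  Translation : (Vect → Vect) → Set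
  Translation f = ∃ λ b → ∀ x → f x ≡ x ✚ b

  Affine : (Vect → Vect) → Set
  Affine f = Σ Carrier λ c → c ≢ 0# × Σ Vect λ b → ∀ x → f x ≡ c ∙ x ✚ b

  Normalizes : (Vect → Vect) → Set
  Normalizes f = (∀ b → ∃ λ c → ∀ x → f (x ✚ b) ≡ f x ✚ c)
               × (∀ c → ∃ λ b → ∀ x → f (x ✚ b) ≡ f x ✚ c)

  -- f conjugates the translation by h to the translation by k.
  Intertwines : (Vect → Vect) → Vect → Vect → Set
  Intertwines f h k = ∀ x → f (x ✚ h) ≡ f x ✚ k

  Centralizes : (Vect → Vect) → List Vect → Set
  Centralizes f = All λ h → Intertwines f h h

  Intertwines-⁻¹ : ∀ {f} (a : Aut f) {h k} → Intertwines f h k → Intertwines (f⁻¹ a) k h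
  Intertwines-⁻¹ {f} a {h} {k} int x = injective a (begin
    f (f⁻¹ a (x ✚ k))  ≡⟨ inverseʳ a _ ⟩
    x ✚ k              ≡⟨ cong (_✚ k) (inverseʳ a x) ⟨
    f (f⁻¹ a x) ✚ k    ≡⟨ int _ ⟨
    f (f⁻¹ a x ✚ h)    ∎)
    where open ≡-Reasoning

  ✚-rightComm : ∀ x y z → x ✚ y ✚ z ≡ x ✚ z ✚ y
  ✚-rightComm = solve 3 (λ x y z → x :+ y :+ z := x :+ z :+ y) refl

  -- The translation by `b` commutes with those by `H`, and conjugation by `f` turns the latter into
  -- the translations by `K`.
  conjugate-centralizes : ∀ {f} (a : Aut f) {H K} → Pointwise (Intertwines f) H K →
                          ∀ b → Centralizes (λ x → f (f⁻¹ a x ✚ b)) K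
  conjugate-centralizes a []           b = []
  conjugate-centralizes {f} a {h ∷ _} {k ∷ _} (int ∷ ints) b = (λ x → begin
    f (f⁻¹ a (x ✚ k) ✚ b)  ≡⟨ cong (λ y → f (y ✚ b)) (Intertwines-⁻¹ a int x) ⟩
    f (f⁻¹ a x ✚ h ✚ b)    ≡⟨ cong f (✚-rightComm _ h b) ⟩
    f (f⁻¹ a x ✚ b ✚ h)    ≡⟨ int _ ⟩
    f (f⁻¹ a x ✚ b) ✚ k    ∎) ∷ conjugate-centralizes a ints b
    where open ≡-Reasoning

  CentralizerIsG : List Vect → Set
  CentralizerIsG H = ∀ f → Aut f → Centralizes f H → Translation f

  -- Conjugation by `f` carries the centralizer of `H` to that of `K`; as both are G, it carries G
  -- to G. The two halves use `f` and its inverse.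
  intertwiner-normalizes : ∀ {f} → Aut f → ∀ {H K} → Pointwise (Intertwines f) H K →
    CentralizerIsG H → CentralizerIsG K → Normalizes f
  intertwiner-normalizes {f} a {H} {K} int H-G K-G = forth , back
    where
    forth : ∀ b → ∃ λ c → ∀ x → f (x ✚ b) ≡ f x ✚ c
    forth b with K-G _ (Aut-∘ a (Aut-∘ (Aut-✚ b) (Aut-⁻¹ a))) (conjugate-centralizes a int b)
    ... | c , eq = c , λ x → trans (cong (λ y → f (y ✚ b)) (sym (inverseˡ a x))) (eq (f x))

    back : ∀ c → ∃ λ b → ∀ x → f (x ✚ b) ≡ f x ✚ c
    back c with H-G _ (Aut-∘ (Aut-⁻¹ a) (Aut-∘ (Aut-✚ c) a))
                  (conjugate-centralizes (Aut-⁻¹ a) (Pointwise.symmetric (Intertwines-⁻¹ a) int) c)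
    ... | b , eq = b , λ x → trans (cong f (sym (eq x))) (inverseʳ a _)

  -- Centralizers of translations by Burnside transfer

  module Centralizers (rigid : ∀ f → Aut f → Normalizes f → Affine f) where
    open import Data.List.Membership.DecPropositional _≟ᵥ_ using (_∈?_)
    open Summation (CommutativeRing.+-isCommutativeMonoid vectorRing)

    -- A nontrivial element of K fixes at most one point, because a nonzero vector determines the
    -- factor of a homothety.
    fixing-affine-id : ∀ {f g} → Affine f → f 𝟎 ≡ 𝟎 → g ≢ 𝟎 → f g ≡ g → ∀ x → f x ≡ x
    fixing-affine-id {f} {g} (c , c≢0 , b , eq) f𝟎 g≢𝟎 fg x = trans (linear x) (trans (cong (_∙ x) c≡1) (1∙ x))
      where
      b≡𝟎 : b ≡ 𝟎
      b≡𝟎 = trans (sym (✚-identityˡ b)) (trans (cong (_✚ b) (sym (∙𝟎 c))) (trans (sym (eq 𝟎)) f𝟎))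
      linear : ∀ x → f x ≡ c ∙ x
      linear x = trans (eq x) (trans (cong (c ∙ x ✚_) b≡𝟎) (✚-identityʳ _))
      c≡1 : c ≡ 1#
      c≡1 = ∙-cancelʳ g≢𝟎 (trans (sym (linear g)) (trans fg (sym (1∙ g))))

    -- Burnside's transfer argument.  The transfer of the centralizer C of H into G is
    -- x ↦ ∑ t x over the stabilizer of 𝟎 in C; it is additive and invariant under
    -- the stabilizer, and restricts to the identity on translations that C does not centralize.
    module Transfer (H : List Vect) {g : Vect} (g∈H : g ∈ H) (g≢𝟎 : g ≢ 𝟎)
                    (larger : ∀ h → h ∉ H → CentralizerIsG (h ∷ H)) where

      Stabilizing : (Vect → Vect) → Set
      Stabilizing f = Aut f × f 𝟎 ≡ 𝟎 × Centralizes f H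

      Stabilizing? : Decidable (λ (t : Table Vect) → Stabilizing (t $_))
      Stabilizing? t = Aut? t ×-dec ((t $ 𝟎) ≟ᵥ 𝟎)
        ×-dec All.all? (λ h → 𝕍.all? λ x → (t $ (x ✚ h)) ≟ᵥ (t $ x ✚ h)) H

      stab : List (Table Vect)
      stab = filter Stabilizing? 𝕋.elements

      stab! : Unique stab
      stab! = Uniqueₚ.filter⁺ Stabilizing? 𝕋.unique

      ∈stab⇒ : ∀ {t} → t ∈ stab → Stabilizing (t $_)
      ∈stab⇒ t∈ = proj₂ (∈-filter⁻ Stabilizing? {xs = 𝕋.elements} t∈)

      table∈stab : ∀ {f} → Stabilizing f → table f ∈ stab
      table∈stab {f} (a , f𝟎 , c) = ∈-filter⁺ Stabilizing? (𝕋.complete _)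
        (Aut-table a , trans (table-$ f 𝟎) f𝟎 ,
         All.map (λ int x → trans (table-$ f _) (trans (int x) (cong (_✚ _) (sym (table-$ f x))))) c)

      -- The translations commuting with `stab`, and hence with the whole centralizer of `H`, which
      -- is generated by `stab` and G.
      Z : Vect → Set
      Z h = All (λ t → Intertwines (t $_) h h) stab

      Z? : Decidable Z
      Z? h = All.all? (λ t → 𝕍.all? λ x → (t $ (x ✚ h)) ≟ᵥ (t $ x ✚ h)) stab

      H⊆Z : ∀ {h} → h ∈ H → Z h
      H⊆Z h∈ = All.tabulate λ t∈ → All.lookup (proj₂ (proj₂ (∈stab⇒ t∈))) h∈

      Z-fix : ∀ {h t} → Z h → t ∈ stab → t $ h ≡ h
      Z-fix {h} {t} Zh t∈ = begin
        t $ h          ≡⟨ cong (t $_) (✚-identityˡ h) ⟨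
        t $ (𝟎 ✚ h)    ≡⟨ All.lookup Zh t∈ 𝟎 ⟩
        t $ 𝟎 ✚ h      ≡⟨ cong (_✚ h) (proj₁ (proj₂ (∈stab⇒ t∈))) ⟩
        𝟎 ✚ h          ≡⟨ ✚-identityˡ h ⟩
        h              ∎
        where open ≡-Reasoning

      Z-isSubgroup : IsSubgroup Z
      Z-isSubgroup = record
        { 𝟎-closed = All.tabulate λ {t} _ x → trans (cong (t $_) (✚-identityʳ x)) (sym (✚-identityʳ _))
        ; ✚-closed = λ {h} {k} Zh Zk → All.tabulate λ {t} t∈ x → begin
            t $ (x ✚ (h ✚ k))  ≡⟨ cong (t $_) (✚-assoc x h k) ⟨
            t $ (x ✚ h ✚ k)    ≡⟨ All.lookup Zk t∈ _ ⟩
            t $ (x ✚ h) ✚ k    ≡⟨ cong (_✚ k) (All.lookup Zh t∈ x) ⟩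
            t $ x ✚ h ✚ k      ≡⟨ ✚-assoc _ h k ⟩
            t $ x ✚ (h ✚ k)    ∎
        ; ─-closed = λ {h} Zh → All.tabulate λ {t} t∈ x → ✚-cancelʳ h (begin
            t $ (x ✚ (𝟎 ─ h)) ✚ h  ≡⟨ All.lookup Zh t∈ _ ⟨
            t $ (x ✚ (𝟎 ─ h) ✚ h)  ≡⟨ cong (t $_) (minus x h) ⟩
            t $ x                  ≡⟨ minus (t $ x) h ⟨
            t $ x ✚ (𝟎 ─ h) ✚ h    ∎)
        }
        where
        open ≡-Reasoning
        minus : ∀ x h → x ✚ (𝟎 ─ h) ✚ h ≡ x
        minus x h = trans (cong (λ y → x ✚ y ✚ h) (✚-identityˡ _))
                          (solve 2 (λ x h → x :+ :- h :+ h := x) refl x h)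

      -- Both `h` and `t $ h` lie outside `H`, so `larger` identifies the centralizers of the two
      -- enlarged families with G. Hence `t` normalizes G and is in K by `rigid`; it fixes `𝟎` and
      -- `g`.
      intertwiner-trivial : ∀ {t h} → t ∈ stab → ¬ Z h → Intertwines (t $_) h (t $ h) → ∀ x → t $ x ≡ x
      intertwiner-trivial {t} {h} t∈ ¬Zh int with ∈stab⇒ t∈
      ... | a , t𝟎 , c = fixing-affine-id
          (rigid _ a (intertwiner-normalizes a (int ∷ All⇒Pointwise c) (larger h h∉) (larger k k∉)))
          t𝟎 g≢𝟎 (Z-fix (H⊆Z g∈H) t∈)
        where
        k = t $ h
        All⇒Pointwise : ∀ {H′} → Centralizes (t $_) H′ → Pointwise (Intertwines (t $_)) H′ H′
        All⇒Pointwise []       = []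
        All⇒Pointwise (c ∷ cs) = c ∷ All⇒Pointwise cs
        h∉ : h ∉ H
        h∉ = ¬Zh ∘ H⊆Z
        -- `t` fixes the members of `H`, so `t $ h` in `H` would give `t $ (t $ h) ≡ t $ h`, and `h`
        -- itself would be in `H`.
        k∉ : k ∉ H
        k∉ k∈ = h∉ (subst (_∈ H) (injective a (Z-fix (H⊆Z k∈) t∈)) k∈)

      -- Writing τ for translations, t τ_h = τ_(t h) ∘ `rebase h t`. Thus `rebase h` is the action
      -- of τ_h on the right cosets of G in the centralizer, with `stab` as transversal, and `t $ h`
      -- is the factor in G that the transfer collects.
      rebase : Vect → Table Vect → Table Vect
      rebase h t = table λ x → t $ (x ✚ h) ─ t $ h

      rebase-$ : ∀ h t x → rebase h t $ x ≡ t $ (x ✚ h) ─ t $ h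
      rebase-$ h t = table-$ _

      rebase-stab : ∀ {h t} → t ∈ stab → rebase h t ∈ stab
      rebase-stab {h} {t} t∈ with ∈stab⇒ t∈
      ... | a , t𝟎 , c = table∈stab
        ( Aut-∘ (Aut-─ (t $ h)) (Aut-∘ a (Aut-✚ h))
        , trans (cong (λ y → t $ y ─ t $ h) (✚-identityˡ h)) (─-self _)
        , All.map (λ {k} int x → trans (cong (_─ t $ h) (trans (cong (t $_) (✚-rightComm x k h)) (int _)))
                                       (✚-rightComm _ k _)) c)

      rebase-rebase : ∀ h k t → rebase h (rebase k t) ≡ rebase (h ✚ k) t
      rebase-rebase h k t = table-unique λ x → begin
        rebase k t $ (x ✚ h) ─ rebase k t $ h
          ≡⟨ cong₂ _─_ (rebase-$ k t _) (rebase-$ k t h) ⟩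
        (t $ (x ✚ h ✚ k) ─ t $ k) ─ (t $ (h ✚ k) ─ t $ k)
          ≡⟨ solve 3 (λ x y z → (x :- z) :- (y :- z) := x :- y) refl _ _ _ ⟩
        t $ (x ✚ h ✚ k) ─ t $ (h ✚ k)
          ≡⟨ cong (λ y → t $ y ─ t $ (h ✚ k)) (✚-assoc x h k) ⟩
        t $ (x ✚ (h ✚ k)) ─ t $ (h ✚ k)
          ≡⟨ rebase-$ (h ✚ k) t x ⟨
        rebase (h ✚ k) t $ x ∎
        where open ≡-Reasoning

      rebase-𝟎 : ∀ {t} → t ∈ stab → rebase 𝟎 t ≡ t
      rebase-𝟎 {t} t∈ = table-unique λ x → begin
        t $ (x ✚ 𝟎) ─ t $ 𝟎  ≡⟨ cong₂ (λ y z → t $ y ─ z) (✚-identityʳ x) (proj₁ (proj₂ (∈stab⇒ t∈))) ⟩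
        t $ x ─ 𝟎            ≡⟨ ─-𝟎 _ ⟩
        t $ x                ∎
        where open ≡-Reasoning

      rebase-⁻¹ : ∀ {h t} → t ∈ stab → rebase (𝟎 ─ h) (rebase h t) ≡ t
      rebase-⁻¹ {h} {t} t∈ = trans (rebase-rebase _ h t) (trans (cong (λ y → rebase y t) (neg h)) (rebase-𝟎 t∈))
        where
        neg : ∀ h → 𝟎 ─ h ✚ h ≡ 𝟎
        neg h = trans (cong (_✚ h) (✚-identityˡ _)) (trans (✚-comm _ h) (─-self h))

      rebase-⁻¹′ : ∀ {h t} → t ∈ stab → rebase h (rebase (𝟎 ─ h) t) ≡ t
      rebase-⁻¹′ {h} {t} t∈ = trans (rebase-rebase h _ t) (trans (cong (λ y → rebase y t) (neg h)) (rebase-𝟎 t∈))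
        where
        neg : ∀ h → h ✚ (𝟎 ─ h) ≡ 𝟎
        neg h = trans (cong (h ✚_) (✚-identityˡ _)) (─-self h)

      transfer : Vect → Vect
      transfer x = ∑ stab (_$ x)

      -- The cocycle rule t(x + y) = t x + (`rebase x t`) y is summed over `stab`, which `rebase x`
      -- permutes.
      transfer-✚ : ∀ x y → transfer (x ✚ y) ≡ transfer x ✚ transfer y
      transfer-✚ x y = begin
        ∑ stab (_$ (x ✚ y))                       ≡⟨ ∑-cong-≗ stab (λ t → split t) ⟩
        ∑ stab (λ t → t $ x ✚ rebase x t $ y)     ≡⟨ ∑-distrib stab _ _ ⟩
        transfer x ✚ ∑ stab (λ t → rebase x t $ y) ≡⟨ cong (transfer x ✚_)
          (∑-reindex stab! (rebase x) (rebase (𝟎 ─ x)) rebase-stab rebase-stab rebase-⁻¹′ rebase-⁻¹ (_$ y)) ⟩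
        transfer x ✚ transfer y                   ∎
        where
        open ≡-Reasoning
        split : ∀ t → t $ (x ✚ y) ≡ t $ x ✚ rebase x t $ y
        split t = begin
          t $ (x ✚ y)                    ≡⟨ solve 2 (λ a b → a := b :+ (a :- b)) refl _ (t $ x) ⟩
          t $ x ✚ (t $ (x ✚ y) ─ t $ x)  ≡⟨ cong (λ z → t $ x ✚ (t $ z ─ t $ x)) (✚-comm x y) ⟩
          t $ x ✚ (t $ (y ✚ x) ─ t $ x)  ≡⟨ cong (t $ x ✚_) (rebase-$ x t y) ⟨
          t $ x ✚ rebase x t $ y         ∎

      -- Composition with `s` on the right permutes `stab`.
      transfer-invariant : ∀ {s} → s ∈ stab → ∀ x → transfer (s $ x) ≡ transfer x
      transfer-invariant {s} s∈ x with ∈stab⇒ s∈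
      ... | a , s𝟎 , c = begin
        ∑ stab (λ t → t $ (s $ x))  ≡⟨ ∑-cong-≗ stab (λ t → sym (table-$ _ x)) ⟩
        ∑ stab (λ t → σ t $ x)      ≡⟨ ∑-reindex stab! σ σ⁻¹ (closed (a , s𝟎 , c)) (closed (Aut-⁻¹ a , s⁻¹𝟎 , c⁻¹))
            (λ {t} _ → table-unique λ y → trans (table-$ _ _) (cong (t $_) (inverseˡ a y)))
            (λ {t} _ → table-unique λ y → trans (table-$ _ _) (cong (t $_) (inverseʳ a y))) (_$ x) ⟩
        ∑ stab (_$ x)               ∎
        where
        open ≡-Reasoning
        σ σ⁻¹ : Table Vect → Table Vect
        σ t   = table λ y → t $ (s $ y)
        σ⁻¹ t = table λ y → t $ f⁻¹ a y
        s⁻¹𝟎 : f⁻¹ a 𝟎 ≡ 𝟎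
        s⁻¹𝟎 = trans (cong (f⁻¹ a) (sym s𝟎)) (inverseˡ a 𝟎)
        c⁻¹ : Centralizes (f⁻¹ a) H
        c⁻¹ = All.map (Intertwines-⁻¹ a) c
        closed : ∀ {f} → Stabilizing f → ∀ {t} → t ∈ stab → table (λ y → t $ f y) ∈ stab
        closed {f} (b , f𝟎 , d) {t} t∈ with ∈stab⇒ t∈
        ... | e , t𝟎 , r = table∈stab (Aut-∘ e b , trans (cong (t $_) f𝟎) t𝟎 ,
              All.zipWith (λ (int , int′) y → trans (cong (t $_) (int y)) (int′ _)) (d , r))

      module _ {h} (¬Zh : ¬ Z h) where
        open IsSubgroup Z-isSubgroup using (ι-faithful)

        idₜ : Table Vect
        idₜ = table id

        idₜ-$ : ∀ x → idₜ $ x ≡ x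
        idₜ-$ = table-$ id

        idₜ∈stab : idₜ ∈ stab
        idₜ∈stab = table∈stab (Aut-≗ ✚-identityʳ (Aut-✚ 𝟎) , refl , All.tabulate λ _ _ → refl)

        nontrivial : List (Table Vect)
        nontrivial = filter (¬? ∘ (_≟ₜ idₜ)) stab

        ∈nontrivial⇒ : ∀ {t} → t ∈ nontrivial → t ∈ stab × t ≢ idₜ
        ∈nontrivial⇒ = ∈-filter⁻ (¬? ∘ (_≟ₜ idₜ))

        rebase-id : ∀ k → rebase k idₜ ≡ idₜ
        rebase-id k = table-unique λ x → trans (cong₂ _─_ (idₜ-$ _) (idₜ-$ k))
          (trans (solve 2 (λ x k → (x :+ k) :- k := x) refl x k) (sym (idₜ-$ x)))

        rebase-nontrivial : ∀ {k t} → t ∈ nontrivial → rebase k t ∈ nontrivial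
        rebase-nontrivial {k} {t} t∈ with ∈nontrivial⇒ t∈
        ... | t∈stab , t≢id = ∈-filter⁺ (¬? ∘ (_≟ₜ idₜ)) (rebase-stab t∈stab) λ eq →
          t≢id (trans (sym (rebase-⁻¹ t∈stab)) (trans (cong (rebase (𝟎 ─ k)) eq) (rebase-id _)))

        step : ℕ → Table Vect → Table Vect
        step i = rebase (ι i ∙ h)

        step-unit : ∀ {t} → t ∈ stab → step 0 t ≡ t
        step-unit t∈ = trans (cong (λ k → rebase k _) (0∙ h)) (rebase-𝟎 t∈)

        step-divide : ∀ {i j s t} → i ℕ.< p → j ℕ.< p → s ∈ stab → step i s ≡ step j t →
                      ∃ λ d → d ℕ.< p × ι d ≡ ι j + - ι i × step d t ≡ s
        step-divide {i} {j} {s} {t} i<p j<p s∈ eq with ι-difference i<p j<p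
        ... | d , d<p , ιd = d , d<p , ιd , (begin
          rebase (ι d ∙ h) t                           ≡⟨ cong (λ c → rebase (c ∙ h) t) ιd ⟩
          rebase ((ι j + - ι i) ∙ h) t                 ≡⟨ cong (λ k → rebase k t) (-‿distrib-∙ (ι j) (ι i) h) ⟩
          rebase (ι j ∙ h ─ ι i ∙ h) t                 ≡⟨ cong (λ k → rebase k t) (flip (ι j ∙ h) (ι i ∙ h)) ⟩
          rebase (𝟎 ─ ι i ∙ h ✚ ι j ∙ h) t             ≡⟨ rebase-rebase _ _ t ⟨
          rebase (𝟎 ─ ι i ∙ h) (step j t)              ≡⟨ cong (rebase _) eq ⟨
          rebase (𝟎 ─ ι i ∙ h) (step i s)              ≡⟨ rebase-⁻¹ s∈ ⟩
          s                                            ∎)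
          where
          open ≡-Reasoning
          flip : ∀ x y → x ─ y ≡ 𝟎 ─ y ✚ x
          flip x y = trans (✚-comm x _) (cong (_✚ x) (sym (✚-identityˡ _)))

        -- If the multiple k = d·h fixes `t` under `rebase`, then t(x + k) = t x + t k for all x.
        -- For d ≠ 0, k is outside `Z` by `ι-faithful`, and `intertwiner-trivial` makes `t` the
        -- identity.
        step-free : ∀ {d t} → d ℕ.< p → t ∈ nontrivial → step d t ≡ t → d ≡ 0
        step-free {d} {t} d<p t∈ eq with d ℕₚ.≟ 0 | ∈nontrivial⇒ t∈
        ... | yes d≡0 | _             = d≡0
        ... | no  d≢0 | t∈stab , t≢id = ⊥-elim (t≢id ($-injective λ x →
            trans (intertwiner-trivial t∈stab (ι-faithful ¬Zh d d≢0 d<p) int x) (sym (idₜ-$ x))))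
          where
          k = ι d ∙ h
          int : Intertwines (t $_) k (t $ k)
          int x = begin
            t $ (x ✚ k)                  ≡⟨ solve 2 (λ a b → a := (a :- b) :+ b) refl _ (t $ k) ⟩
            (t $ (x ✚ k) ─ t $ k) ✚ t $ k ≡⟨ cong (_✚ t $ k) (rebase-$ k t x) ⟨
            rebase k t $ x ✚ t $ k       ≡⟨ cong (λ s → s $ x ✚ t $ k) eq ⟩
            t $ x ✚ t $ k                ∎
            where open ≡-Reasoning

        ∑-telescope : ∀ (f : ℕ → Vect) m → ∑ (downFrom m) (λ i → f (suc i) ─ f i) ≡ f m ─ f 0
        ∑-telescope f zero    = sym (─-self (f 0))
        ∑-telescope f (suc m) = trans (cong (f (suc m) ─ f m ✚_) (∑-telescope f m))
          (solve 3 (λ a b c → a :- b :+ (b :- c) := a :- c) refl (f (suc m)) (f m) (f 0))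

        -- The identity of `stab` contributes `h`. The other elements fall into free orbits under
        -- the multiples of `h`, and the sum over the orbit of `t` telescopes to t(p·h) - t(0·h) =
        -- 0.
        transfer-id : transfer h ≡ h
        transfer-id = begin
          transfer h                                             ≡⟨ ∑-filter (_≟ₜ idₜ) stab _ ⟩
          ∑ (filter (_≟ₜ idₜ) stab) (_$ h) ✚ ∑ nontrivial (_$ h)  ≡⟨ cong₂ _✚_ identity-part
              (∑-free-orbits _≟ₜ_ (downFrom p) (Uniqueₚ.downFrom⁺ p) step (_$ h) nontrivial
                 (Uniqueₚ.filter⁺ _ stab!) freeOn) ⟩
          h ✚ 𝟎                                                  ≡⟨ ✚-identityʳ h ⟩
          h                                                      ∎
          where
          open ≡-Reasoning
          identity-part : ∑ (filter (_≟ₜ idₜ) stab) (_$ h) ≡ h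
          identity-part = trans (∑-single (Uniqueₚ.filter⁺ (_≟ₜ idₜ) stab!)
              (∈-filter⁺ (_≟ₜ idₜ) idₜ∈stab refl) (_$ h)
              (λ t∈ t≢ → ⊥-elim (t≢ (proj₂ (∈-filter⁻ (_≟ₜ idₜ) {xs = stab} t∈))))) (idₜ-$ h)

          freeOn : FreeOn _≟ₜ_ (downFrom p) (Uniqueₚ.downFrom⁺ p) step (_$ h) nontrivial
          freeOn = record
            { closed  = λ _ → rebase-nontrivial
            ; unit    = λ t∈ → 0 , ∈-downFrom⁺ 0<p , step-unit (proj₁ (∈nontrivial⇒ t∈))
            ; divide  = λ b∈ c∈ s∈ _ eq →
                let (d , d<p , _ , eq′) = step-divide (∈-downFrom⁻ b∈) (∈-downFrom⁻ c∈) (proj₁ (∈nontrivial⇒ s∈)) eq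
                in d , ∈-downFrom⁺ d<p , eq′
            ; free    = λ b∈ c∈ t∈ eq →
                let (d , d<p , ιd , eq′) = step-divide (∈-downFrom⁻ b∈) (∈-downFrom⁻ c∈) (proj₁ (∈nontrivial⇒ t∈)) eq
                in ι-injective (∈-downFrom⁻ b∈) (∈-downFrom⁻ c∈)
                     (sym (+-cancel (trans (sym ιd) (cong ι (step-free d<p t∈ eq′)))))
            ; ∑-orbit = λ {t} t∈ → begin
                ∑ (downFrom p) (λ i → step i t $ h)                            ≡⟨ ∑-cong-≗ (downFrom p) (λ i → rebase-$ _ t h) ⟩
                ∑ (downFrom p) (λ i → t $ (h ✚ ι i ∙ h) ─ t $ (ι i ∙ h))       ≡⟨ ∑-cong-≗ (downFrom p) (λ i →
                    cong (λ k → t $ k ─ t $ (ι i ∙ h)) (sym (trans (+-distrib-∙ 1# (ι i) h) (cong (_✚ ι i ∙ h) (1∙ h))))) ⟩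
                ∑ (downFrom p) (λ i → t $ (ι (suc i) ∙ h) ─ t $ (ι i ∙ h))     ≡⟨ ∑-telescope (λ i → t $ (ι i ∙ h)) p ⟩
                t $ (ι p ∙ h) ─ t $ (0# ∙ h)                                   ≡⟨ cong (λ c → t $ (c ∙ h) ─ t $ (0# ∙ h)) ι-p ⟩
                t $ (0# ∙ h) ─ t $ (0# ∙ h)                                    ≡⟨ ─-self _ ⟩
                𝟎                                                              ∎
            }

      -- If `Z` is everything, `s` fixes every vector. Otherwise d = s x - x is killed by the
      -- transfer, so it is in `Z`, as outside `Z` the transfer is the identity. For `h` outside `Z`
      -- the sum h + d is outside too, so h + d = transfer (h + d) = transfer h = h.
      stab-trivial : ∀ {s} → s ∈ stab → ∀ x → s $ x ≡ x
      stab-trivial {s} s∈ x with 𝕍.any? (¬? ∘ Z?)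
      ... | no  all-Z      = Z-fix (decidable-stable (Z? x) (λ ¬Zx → all-Z (x , ¬Zx))) s∈
      ... | yes (h , ¬Zh) = ─-cancel (begin
          d       ≡⟨ solve 2 (λ h d → d := (h :+ d) :- h) refl h d ⟩
          (h ✚ d) ─ h                    ≡⟨ cong (_─ h) (transfer-id ¬Zhd) ⟨
          transfer (h ✚ d) ─ h           ≡⟨ cong (_─ h) (transfer-✚ h d) ⟩
          (transfer h ✚ transfer d) ─ h  ≡⟨ cong₂ (λ a b → (a ✚ b) ─ h) (transfer-id ¬Zh) transfer-d ⟩
          (h ✚ 𝟎) ─ h                    ≡⟨ cong (_─ h) (✚-identityʳ h) ⟩
          h ─ h                          ≡⟨ ─-self h ⟩
          𝟎                              ∎)
        where
        open ≡-Reasoning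
        open IsSubgroup Z-isSubgroup
        d = s $ x ─ x
        transfer-d : transfer d ≡ 𝟎
        transfer-d = begin
          transfer d                              ≡⟨ solve 2 (λ a b → a := (a :+ b) :- b) refl _ (transfer x) ⟩
          (transfer d ✚ transfer x) ─ transfer x  ≡⟨ cong (_─ transfer x) (transfer-✚ d x) ⟨
          transfer (d ✚ x) ─ transfer x           ≡⟨ cong (λ y → transfer y ─ transfer x) (solve 2 (λ a b → a :- b :+ b := a) refl (s $ x) x) ⟩
          transfer (s $ x) ─ transfer x           ≡⟨ cong (_─ transfer x) (transfer-invariant s∈ x) ⟩
          transfer x ─ transfer x                 ≡⟨ ─-self _ ⟩
          𝟎                                       ∎
        Zd : Z d
        Zd with Z? d
        ... | yes Zd  = Zd
        -- Outside `Z` the vector `d` would equal its transfer 0, which is in `Z`.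
        ... | no ¬Zd = subst Z (trans (sym transfer-d) (transfer-id ¬Zd)) 𝟎-closed
        ¬Zhd : ¬ Z (h ✚ d)
        ¬Zhd Zhd = ¬Zh (subst Z (trans (cong (h ✚ d ✚_) (✚-identityˡ _)) (solve 2 (λ h d → h :+ d :+ :- d := h) refl h d))
                        (✚-closed Zhd (─-closed Zd)))

      centralizerIsG : CentralizerIsG H
      centralizerIsG f a c = f 𝟎 , λ x → begin
        f x                      ≡⟨ solve 2 (λ a b → a := (a :- b) :+ b) refl (f x) (f 𝟎) ⟩
        (f x ─ f 𝟎) ✚ f 𝟎        ≡⟨ cong (_✚ f 𝟎) (table-$ f₀ x) ⟨
        table f₀ $ x ✚ f 𝟎       ≡⟨ cong (_✚ f 𝟎) (stab-trivial (table∈stab f₀-stab) x) ⟩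
        x ✚ f 𝟎                  ∎
        where
        open ≡-Reasoning
        f₀ : Vect → Vect
        f₀ x = f x ─ f 𝟎
        f₀-stab : Stabilizing f₀
        f₀-stab = Aut-∘ (Aut-─ (f 𝟎)) a , ─-self _ ,
          All.map (λ {h} int x → trans (cong (_─ f 𝟎) (int x)) (✚-rightComm _ h _)) c

    -- Induction on the number of vectors outside `H`. When none is left, the hypothesis `larger` of
    -- the transfer argument is vacuous.
    nontrivial⇒CentralizerIsG : ∀ H {g} → g ∈ H → g ≢ 𝟎 → CentralizerIsG H
    nontrivial⇒CentralizerIsG H = go _ H ℕₚ.≤-refl
      where
      outside : List Vect → List Vect
      outside H = filter (¬? ∘ (_∈? H)) 𝕍.elements
      go : ∀ m H → length (outside H) ℕ.≤ m → ∀ {g} → g ∈ H → g ≢ 𝟎 → CentralizerIsG H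
      go m H ≤m g∈ g≢𝟎 = Transfer.centralizerIsG H g∈ g≢𝟎 (larger m ≤m)
        where
        larger : ∀ m → length (outside H) ℕ.≤ m → ∀ h → h ∉ H → CentralizerIsG (h ∷ H)
        larger m ≤m h h∉ with ℕₚ.≤-trans (filter-length-< (¬? ∘ (_∈? H)) (¬? ∘ (_∈? (h ∷ H)))
                                 (_∘ there) 𝕍.elements (𝕍.complete h) h∉ (λ ¬∈ → ¬∈ (here refl))) ≤m
        larger (suc m) _ h h∉ | ℕ.s≤s <m = go m (h ∷ H) <m (there g∈) g≢𝟎

    -- Distinct conjugates of G intersect trivially, and G is normalized only by K.
    abstract
      intertwiner-affine : ∀ {f} → Aut f → ∀ {g h} → g ≢ 𝟎 → Intertwines f g h → Affine f
      intertwiner-affine {f} a {g} {h} g≢𝟎 int = rigid f a (intertwiner-normalizes a (int ∷ [])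
        (nontrivial⇒CentralizerIsG _ (here refl) g≢𝟎) (nontrivial⇒CentralizerIsG _ (here refl) h≢𝟎))
        where
        h≢𝟎 : h ≢ 𝟎
        h≢𝟎 refl = g≢𝟎 (✚-cancelˡ 𝟎 (trans (injective a (trans (int 𝟎) (✚-identityʳ _))) (sym (✚-identityʳ 𝟎))))

-- Second moments over the automorphism group

module Counting (F : FiniteField) (n : ℕ) (S : V F n → Bool) (K≤Aut : KLeAut F S) where
  open Graph F n S K≤Aut hiding (_*_)
  open Aut
  open IntegerSums
  open VS using (solve; _:=_; _:+_; :-_; _:-_)
  module 𝔽 = Enumeration enumerate-field

  ∑-rotate : ∀ (xs : List I) (ys : List J) (zs : List L) (f : I → J → L → ℤ) →
    ∑ xs (λ x → ∑ ys λ y → ∑ zs λ z → f x y z) ≡ ∑ ys (λ y → ∑ zs λ z → ∑ xs λ x → f x y z)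
  ∑-rotate xs ys zs f = trans (∑-swap xs ys _) (∑-cong-≗ ys λ y → ∑-swap xs zs _)

  ∑-cartesianProduct : ∀ (xs : List I) (ys : List J) (f : I × J → ℤ) →
    ∑ (cartesianProduct xs ys) f ≡ ∑ xs (λ x → ∑ ys λ y → f (x , y))
  ∑-cartesianProduct []       ys f = refl
  ∑-cartesianProduct (x ∷ xs) ys f = trans (∑-++ (map (x ,_) ys) _ f)
    (cong₂ ℤ._+_ (∑-map (x ,_) ys f) (∑-cartesianProduct xs ys f))

  auts : List (Table Vect)
  auts = filter Aut? 𝕋.elements

  auts! : Unique auts
  auts! = Uniqueₚ.filter⁺ Aut? 𝕋.unique

  ∈auts⇒ : ∀ {t} → t ∈ auts → Aut (t $_)
  ∈auts⇒ t∈ = proj₂ (∈-filter⁻ Aut? {xs = 𝕋.elements} t∈)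

  table∈auts : ∀ {f} → Aut f → table f ∈ auts
  table∈auts a = ∈-filter⁺ Aut? (𝕋.complete _) (Aut-table a)

  vectors : List Vect
  vectors = 𝕍.elements

  units : List Carrier
  units = filter (¬? ∘ (_≟ 0#)) 𝔽.elements

  units! : Unique units
  units! = Uniqueₚ.filter⁺ (¬? ∘ (_≟ 0#)) 𝔽.unique

  ∈units⇒ : ∀ {c} → c ∈ units → c ≢ 0#
  ∈units⇒ c∈ = proj₂ (∈-filter⁻ (¬? ∘ (_≟ 0#)) {xs = 𝔽.elements} c∈)

  ∈units : ∀ {c} → c ≢ 0# → c ∈ units
  ∈units = ∈-filter⁺ (¬? ∘ (_≟ 0#)) (𝔽.complete _)

  ∑-vectors : ∀ {f} → Aut f → (w : Vect → ℤ) → ∑ vectors (w ∘ f) ≡ ∑ vectors w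
  ∑-vectors {f} a = ∑-reindex 𝕍.unique f (f⁻¹ a) (λ _ → 𝕍.complete _) (λ _ → 𝕍.complete _)
    (λ {x} _ → inverseʳ a x) (λ {x} _ → inverseˡ a x)

  ∑-auts : ∀ {f g} → Aut f → Aut g → (w : Table Vect → ℤ) →
           ∑ auts (λ t → w (table λ x → f (t $ g x))) ≡ ∑ auts w
  ∑-auts {f} {g} a b = ∑-reindex auts! _ (λ t → table λ x → f⁻¹ a (t $ f⁻¹ b x))
    (λ t∈ → table∈auts (Aut-∘ a (Aut-∘ (∈auts⇒ t∈) b)))
    (λ t∈ → table∈auts (Aut-∘ (Aut-⁻¹ a) (Aut-∘ (∈auts⇒ t∈) (Aut-⁻¹ b))))
    (λ {t} _ → table-unique λ x → trans (cong f (table-$ _ _))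
       (trans (inverseʳ a _) (cong (t $_) (inverseˡ b x))))
    (λ {t} _ → table-unique λ x → trans (cong (f⁻¹ a) (table-$ _ _))
       (trans (inverseˡ a _) (cong (t $_) (inverseʳ b x))))

  |V| |A| |U| : ℤ
  |V| = + length vectors
  |A| = + length auts
  |U| = + length units

  module Moments (z : Vect → ℤ)
                 (z-invariant : ∀ {f} → Aut f → ∀ u v → z (f u ─ f v) ≡ z (u ─ v))
                 (z-𝟎 : z 𝟎 ≡ 0ℤ) (∑z : ∑ vectors z ≡ 0ℤ) where
    open import Data.Integer.Base using (_*_; _≤_)
    open ≡-Reasoning

    based : Table Vect → Vect → Vect
    based t r = t $ r ─ t $ 𝟎

    moment : Table Vect → ℤ
    moment t = ∑ vectors λ x → z (t $ x ─ x)

    Q ζ : ℤ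
    Q = ∑ auts λ t → moment t * moment t
    ζ = ∑ vectors λ x → z x * z x

    -- Both sides are q^n times the sum of `W`. On the left, b is shifted by t r and then absorbed
    -- into t as a translation after it. On the right, the second variable of the squared moment is
    -- written r + x, and t is conjugated by the translation by x.
    Q-correlation : ∑ auts (λ t → ∑ vectors λ r → ∑ vectors λ b → z (b ─ based t r) * z (b ─ r)) ≡ Q
    Q-correlation = trans left (sym right)
      where
      W : Table Vect → Vect → ℤ
      W t r = z (t $ 𝟎) * z (t $ r ─ r)

      left : ∑ auts (λ t → ∑ vectors λ r → ∑ vectors λ b → z (b ─ based t r) * z (b ─ r))
             ≡ ∑ vectors (λ _ → ∑ auts λ t → ∑ vectors λ r → W t r)
      left = begin
        ∑ auts (λ t → ∑ vectors λ r → ∑ vectors λ b → z (b ─ based t r) * z (b ─ r))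
          ≡⟨ (∑-cong-≗ auts λ t → ∑-cong-≗ vectors λ r → sym (∑-vectors (Aut-✚ (t $ r)) _)) ⟩
        ∑ auts (λ t → ∑ vectors λ r → ∑ vectors λ b → z (b ✚ t $ r ─ based t r) * z (b ✚ t $ r ─ r))
          ≡⟨ (∑-cong-≗ auts λ t → ∑-cong-≗ vectors λ r → ∑-cong-≗ vectors λ b → rewrite-W t r b) ⟩
        ∑ auts (λ t → ∑ vectors λ r → ∑ vectors λ b → W (table λ x → t $ x ✚ b) r)
          ≡⟨ (∑-cong-≗ auts λ t → ∑-swap vectors vectors _) ⟩
        ∑ auts (λ t → ∑ vectors λ b → ∑ vectors λ r → W (table λ x → t $ x ✚ b) r)
          ≡⟨ ∑-swap auts vectors _ ⟩
        ∑ vectors (λ b → ∑ auts λ t → ∑ vectors λ r → W (table λ x → t $ x ✚ b) r)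
          ≡⟨ (∑-cong-≗ vectors λ b → ∑-auts (Aut-✚ b) (Aut-≗ ✚-identityʳ (Aut-✚ 𝟎)) λ t → ∑ vectors (W t)) ⟩
        ∑ vectors (λ _ → ∑ auts λ t → ∑ vectors λ r → W t r) ∎
        where
        rewrite-W : ∀ t r b → z (b ✚ t $ r ─ based t r) * z (b ✚ t $ r ─ r) ≡ W (table λ x → t $ x ✚ b) r
        rewrite-W t r b = cong₂ (λ x y → z x * z y)
          (trans (solve 3 (λ b r o → b :+ r :- (r :- o) := o :+ b) refl b (t $ r) (t $ 𝟎)) (sym (table-$ _ 𝟎)))
          (cong (_─ r) (trans (✚-comm b _) (sym (table-$ _ r))))

      right : Q ≡ ∑ vectors (λ _ → ∑ auts λ t → ∑ vectors λ r → W t r)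
      right = begin
        ∑ auts (λ t → moment t * moment t)
          ≡⟨ (∑-cong-≗ auts λ t → ∑-*-∑ vectors _ vectors _) ⟩
        ∑ auts (λ t → ∑ vectors λ x → ∑ vectors λ y → z (t $ x ─ x) * z (t $ y ─ y))
          ≡⟨ ∑-swap auts vectors _ ⟩
        ∑ vectors (λ x → ∑ auts λ t → ∑ vectors λ y → z (t $ x ─ x) * z (t $ y ─ y))
          ≡⟨ (∑-cong-≗ vectors λ x → ∑-cong-≗ auts λ t → sym (∑-vectors (Aut-✚ x) _)) ⟩
        ∑ vectors (λ x → ∑ auts λ t → ∑ vectors λ r → z (t $ x ─ x) * z (t $ (r ✚ x) ─ (r ✚ x)))
          ≡⟨ (∑-cong-≗ vectors λ x → ∑-cong-≗ auts λ t → ∑-cong-≗ vectors λ r → rewrite-W x t r) ⟩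
        ∑ vectors (λ x → ∑ auts λ t → ∑ vectors λ r → W (table λ y → t $ (y ✚ x) ─ x) r)
          ≡⟨ (∑-cong-≗ vectors λ x → ∑-auts (Aut-─ x) (Aut-✚ x) λ t → ∑ vectors (W t)) ⟩
        ∑ vectors (λ _ → ∑ auts λ t → ∑ vectors λ r → W t r) ∎
        where
        rewrite-W : ∀ x t r → z (t $ x ─ x) * z (t $ (r ✚ x) ─ (r ✚ x)) ≡ W (table λ y → t $ (y ✚ x) ─ x) r
        rewrite-W x t r = cong₂ (λ x y → z x * z y)
          (trans (cong (λ y → t $ y ─ x) (sym (✚-identityˡ x))) (sym (table-$ _ 𝟎)))
          (trans (solve 3 (λ a r x → a :- (r :+ x) := a :- x :- r) refl _ r x) (cong (_─ r) (sym (table-$ _ r))))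

    -- The Z(b,r) of the overview, not divided by q - 1.
    average : Vect → Vect → ℤ
    average b r = ∑ units λ c → z (b ─ c ∙ r)

    E : ℤ
    E = ∑ vectors λ r → ∑ vectors λ b → average b r * average b r

    -- For c ≠ d the substitution b + c r for b leaves z(b) z((c - d) r + b), whose sum over r
    -- vanishes with `∑z`. Only the diagonal c = d remains.
    E-value : E ≡ |U| * (|V| * ζ)
    E-value = begin
      E
        ≡⟨ (∑-cong-≗ vectors λ r → ∑-cong-≗ vectors λ b → ∑-*-∑ units _ units _) ⟩
      ∑ vectors (λ r → ∑ vectors λ b → ∑ units λ c → ∑ units λ d → z (b ─ c ∙ r) * z (b ─ d ∙ r))
        ≡⟨ (∑-cong-≗ vectors λ r → ∑-rotate vectors units units _) ⟩
      ∑ vectors (λ r → ∑ units λ c → ∑ units λ d → ∑ vectors λ b → z (b ─ c ∙ r) * z (b ─ d ∙ r))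
        ≡⟨ ∑-rotate vectors units units _ ⟩
      ∑ units (λ c → ∑ units λ d → e c d)
        ≡⟨ ∑-cong units (λ {c} c∈ → trans (∑-single units! c∈ (e c) (λ _ d≢c → off-diagonal (d≢c ∘ sym))) (diagonal c)) ⟩
      ∑ units (λ _ → |V| * ζ)
        ≡⟨ ∑-const units _ ⟩
      |U| * (|V| * ζ) ∎
      where
      e : Carrier → Carrier → ℤ
      e c d = ∑ vectors λ r → ∑ vectors λ b → z (b ─ c ∙ r) * z (b ─ d ∙ r)

      diagonal : ∀ c → e c c ≡ |V| * ζ
      diagonal c = trans (∑-cong-≗ vectors λ r → ∑-vectors (Aut-─ (c ∙ r)) (λ b → z b * z b)) (∑-const vectors ζ)

      off-diagonal : ∀ {c d} → c ≢ d → e c d ≡ 0ℤ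
      off-diagonal {c} {d} c≢d = begin
        ∑ vectors (λ r → ∑ vectors λ b → z (b ─ c ∙ r) * z (b ─ d ∙ r))
          ≡⟨ (∑-cong-≗ vectors λ r → sym (∑-vectors (Aut-✚ (c ∙ r)) _)) ⟩
        ∑ vectors (λ r → ∑ vectors λ b → z (b ✚ c ∙ r ─ c ∙ r) * z (b ✚ c ∙ r ─ d ∙ r))
          ≡⟨ (∑-cong-≗ vectors λ r → ∑-cong-≗ vectors λ b → cong₂ (λ x y → z x * z y)
               (solve 2 (λ b x → b :+ x :- x := b) refl b (c ∙ r))
               (trans (solve 3 (λ b x y → b :+ x :- y := (x :- y) :+ b) refl b (c ∙ r) (d ∙ r))
                      (cong (_✚ b) (sym (-‿distrib-∙ c d r))))) ⟩
        ∑ vectors (λ r → ∑ vectors λ b → z b * z ((c + - d) ∙ r ✚ b))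
          ≡⟨ ∑-swap vectors vectors _ ⟩
        ∑ vectors (λ b → ∑ vectors λ r → z b * z ((c + - d) ∙ r ✚ b))
          ≡⟨ ∑-ε vectors (λ {b} _ → trans (sym (*-∑ (z b) vectors _))
               (trans (cong (z b *_) (trans (∑-vectors (Aut-affine (c≢d ∘ +-cancel) b) z) ∑z)) (ℤₚ.*-zeroʳ (z b)))) ⟩
        0ℤ ∎

    ∑₃ : (Table Vect → Vect → Vect → ℤ) → ℤ
    ∑₃ f = ∑ auts λ t → ∑ vectors λ r → ∑ vectors λ b → f t r b

    ∑₃-distrib : ∀ f g → ∑₃ (λ t r b → f t r b ℤ.+ g t r b) ≡ ∑₃ f ℤ.+ ∑₃ g
    ∑₃-distrib f g = trans (∑-cong-≗ auts λ t →
        trans (∑-cong-≗ vectors λ r → ∑-distrib vectors (f t r) (g t r)) (∑-distrib vectors _ _))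
      (∑-distrib auts _ _)

    -- For each pair of scalars, replacing r by d⁻¹ r and t by c t d⁻¹, again an automorphism,
    -- reduces the sum to `Q-correlation`.
    cross : ∑₃ (λ t r b → average b (based t r) * average b r) ≡ |U| * (|U| * Q)
    cross = begin
      ∑₃ (λ t r b → average b (based t r) * average b r)
        ≡⟨ (∑-cong-≗ auts λ t → ∑-cong-≗ vectors λ r → ∑-cong-≗ vectors λ b → ∑-*-∑ units _ units _) ⟩
      ∑ auts (λ t → ∑ vectors λ r → ∑ vectors λ b → ∑ units λ c → ∑ units λ d → w c d t r b)
        ≡⟨ (∑-cong-≗ auts λ t → ∑-cong-≗ vectors λ r → ∑-rotate vectors units units _) ⟩
      ∑ auts (λ t → ∑ vectors λ r → ∑ units λ c → ∑ units λ d → ∑ vectors λ b → w c d t r b)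
        ≡⟨ (∑-cong-≗ auts λ t → ∑-rotate vectors units units _) ⟩
      ∑ auts (λ t → ∑ units λ c → ∑ units λ d → ∑ vectors λ r → ∑ vectors λ b → w c d t r b)
        ≡⟨ ∑-rotate auts units units _ ⟩
      ∑ units (λ c → ∑ units λ d → ∑₃ (w c d))
        ≡⟨ ∑-cong units (λ c∈ → ∑-cong units λ d∈ → rescale (∈units⇒ c∈) (∈units⇒ d∈)) ⟩
      ∑ units (λ _ → ∑ units λ _ → Q)
        ≡⟨ trans (∑-cong-≗ units λ _ → ∑-const units Q) (∑-const units _) ⟩
      |U| * (|U| * Q) ∎
      where
      w : Carrier → Carrier → Table Vect → Vect → Vect → ℤ
      w c d t r b = z (b ─ c ∙ based t r) * z (b ─ d ∙ r)

      rescale : ∀ {c d} → c ≢ 0# → d ≢ 0# → ∑₃ (w c d) ≡ Q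
      rescale {c} {d} c≢0 d≢0 = begin
        ∑ auts (λ t → ∑ vectors λ r → ∑ vectors λ b → w c d t r b)
          ≡⟨ (∑-cong-≗ auts λ t → sym (∑-vectors (Aut-∙ (⁻¹-≢0 d≢0)) _)) ⟩
        ∑ auts (λ t → ∑ vectors λ r → ∑ vectors λ b → w c d t (d⁻¹ ∙ r) b)
          ≡⟨ (∑-cong-≗ auts λ t → ∑-cong-≗ vectors λ r → ∑-cong-≗ vectors λ b →
               cong₂ (λ x y → z (b ─ x) * z (b ─ y)) (based-scaled t r) (∙-inverse d≢0 r)) ⟩
        ∑ auts (λ t → ∑ vectors λ r → ∑ vectors λ b → z (b ─ based (scaled t) r) * z (b ─ r))
          ≡⟨ ∑-auts (Aut-∙ c≢0) (Aut-∙ (⁻¹-≢0 d≢0)) (λ t → ∑ vectors λ r → ∑ vectors λ b → z (b ─ based t r) * z (b ─ r)) ⟩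
        ∑ auts (λ t → ∑ vectors λ r → ∑ vectors λ b → z (b ─ based t r) * z (b ─ r))
          ≡⟨ Q-correlation ⟩
        Q ∎
        where
        d⁻¹ = d ⁻¹⟨ d≢0 ⟩
        scaled : Table Vect → Table Vect
        scaled t = table λ x → c ∙ (t $ (d⁻¹ ∙ x))
        based-scaled : ∀ t r → c ∙ based t (d⁻¹ ∙ r) ≡ based (scaled t) r
        based-scaled t r = trans (∙-distrib-─ c _ _) (cong₂ _─_ (sym (table-$ _ r))
          (trans (cong (λ x → c ∙ (t $ x)) (sym (∙𝟎 d⁻¹))) (sym (table-$ _ 𝟎))))

    deviation : Table Vect → Vect → Vect → ℤ
    deviation t r b = average b (based t r) ℤ.- average b r

    -- Expansion of the square. Both pure squares sum to `|A| * E`, since r ↦ t r - t 0 is a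
    -- permutation of the vectors.
    variance : ∑₃ (λ t r b → deviation t r b * deviation t r b) ℤ.+ (|U| * (|U| * Q) ℤ.+ |U| * (|U| * Q))
               ≡ |A| * E ℤ.+ |A| * E
    variance = begin
      ∑₃ (λ t r b → deviation t r b * deviation t r b) ℤ.+ (|U| * (|U| * Q) ℤ.+ |U| * (|U| * Q))
        ≡⟨ cong (λ X → ∑₃ (λ t r b → deviation t r b * deviation t r b) ℤ.+ (X ℤ.+ X)) cross ⟨
      ∑₃ (λ t r b → deviation t r b * deviation t r b) ℤ.+ (∑₃ xy ℤ.+ ∑₃ xy)
        ≡⟨ cong (λ X → ∑₃ (λ t r b → deviation t r b * deviation t r b) ℤ.+ X) (∑₃-distrib xy xy) ⟨
      ∑₃ (λ t r b → deviation t r b * deviation t r b) ℤ.+ ∑₃ (λ t r b → xy t r b ℤ.+ xy t r b)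
        ≡⟨ ∑₃-distrib _ _ ⟨
      ∑₃ (λ t r b → deviation t r b * deviation t r b ℤ.+ (xy t r b ℤ.+ xy t r b))
        ≡⟨ (∑-cong-≗ auts λ t → ∑-cong-≗ vectors λ r → ∑-cong-≗ vectors λ b →
             ℤS.solve 2 (λ x y → (x ℤS.:- y) ℤS.:* (x ℤS.:- y) ℤS.:+ (x ℤS.:* y ℤS.:+ x ℤS.:* y)
                                   ℤS.:= x ℤS.:* x ℤS.:+ y ℤS.:* y) refl (average b (based t r)) (average b r)) ⟩
      ∑₃ (λ t r b → xx t r b ℤ.+ yy t r b)
        ≡⟨ ∑₃-distrib xx yy ⟩
      ∑₃ xx ℤ.+ ∑₃ yy
        ≡⟨ cong₂ ℤ._+_ (trans (∑-cong auts λ t∈ → ∑-vectors (Aut-∘ (Aut-─ _) (∈auts⇒ t∈)) _) (∑-const auts E))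
                       (∑-const auts E) ⟩
      |A| * E ℤ.+ |A| * E ∎
      where
      module ℤS = ℤSolver.+-*-Solver
      xx yy xy : Table Vect → Vect → Vect → ℤ
      xx t r b = average b (based t r) * average b (based t r)
      yy t r b = average b r * average b r
      xy t r b = average b (based t r) * average b r

    -- Fibres of conjugation and equality of the bounds

    module _ (rigid : ∀ f → Aut f → Normalizes f → Affine f) where
      open Centralizers rigid using (intertwiner-affine)

      pairs : List (Table Vect × Vect)
      pairs = cartesianProduct auts vectors

      pairs! : Unique pairs
      pairs! = Uniqueₚ.cartesianProduct⁺ auts! 𝕍.unique

      -- The translation by `g` conjugated by `t`. The value `t` for tables that are not
      -- automorphisms is a placeholder, never met on `pairs`.
      conjugate : Table Vect × Vect → Table Vect
      conjugate (t , g) with Aut? t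
      ... | yes a = table λ x → t $ (f⁻¹ a x ✚ g)
      ... | no  _ = t

      conjugate-$ : ∀ {t} → Aut (t $_) → ∀ g x → conjugate (t , g) $ (t $ x) ≡ t $ (x ✚ g)
      conjugate-$ {t} a g x with Aut? t
      ... | yes a′ = trans (table-$ _ _) (cong (λ y → t $ (y ✚ g)) (inverseˡ a′ x))
      ... | no ¬a  = ⊥-elim (¬a a)

      conjugate∈auts : ∀ {tg} → tg ∈ pairs → conjugate tg ∈ auts
      conjugate∈auts {t , g} tg∈ with Aut? t
      ... | yes a  = table∈auts (Aut-∘ a (Aut-∘ (Aut-✚ g) (Aut-⁻¹ a)))
      ... | no ¬a  = ⊥-elim (¬a (∈auts⇒ (proj₁ (∈-cartesianProduct⁻ auts vectors tg∈))))

      -- With t x in place of x each term becomes z(t(x + g) - t x), which is z(g) by invariance.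
      moment-conjugate : ∀ {t} → Aut (t $_) → ∀ g → moment (conjugate (t , g)) ≡ |V| * z g
      moment-conjugate {t} a g = begin
        ∑ vectors (λ x → z (conjugate (t , g) $ x ─ x))
          ≡⟨ ∑-vectors a _ ⟨
        ∑ vectors (λ x → z (conjugate (t , g) $ (t $ x) ─ t $ x))
          ≡⟨ (∑-cong-≗ vectors λ x → trans (cong (λ y → z (y ─ t $ x)) (conjugate-$ a g x))
               (trans (z-invariant a _ x) (cong z (solve 2 (λ x g → x :+ g :- x := g) refl x g)))) ⟩
        ∑ vectors (λ _ → z g)
          ≡⟨ ∑-const vectors (z g) ⟩
        |V| * z g ∎

      -- Made total, with a dummy value at `0#`, so that `ψ` below can be defined on all pairs
      -- without a proof of nonvanishing.
      inv : Carrier → Carrier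
      inv c with c ≟ 0#
      ... | yes _   = 0#
      ... | no c≢0 = c ⁻¹⟨ c≢0 ⟩

      inv-∙ : ∀ {c} → c ≢ 0# → ∀ x → inv c ∙ (c ∙ x) ≡ x
      inv-∙ {c} c≢0 x with c ≟ 0#
      ... | yes c≡0 = ⊥-elim (c≢0 c≡0)
      ... | no c≢0′ = ∙-inverse′ c≢0′ x

      -- Two pairs with the same conjugate differ by an element of K, and |K| = |units| · |vectors|.
      conjugate-fibre : ∀ {a} → moment a * moment a ≢ 0ℤ → ∀ {fib} → Unique fib →
        (∀ {tg} → tg ∈ fib → tg ∈ pairs × conjugate tg ≡ a) →
        length fib ℕ.≤ length units ℕ.* length vectors
      conjugate-fibre moment≢0 {[]} _ _ = ℕ.z≤n
      conjugate-fibre {a} moment≢0 {fib@((s , h) ∷ _)} fib! fib⇒ = subst (length fib ℕ.≤_)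
          (trans (Listₚ.length-map ψ (cartesianProduct units vectors)) (length-cartesianProductWith _,_ units vectors))
          (unique-⊆-length fib! covered)
        where
        ψ : Carrier × Vect → Table Vect × Vect
        -- The head `(s , h)` serves as base point: if s⁻¹t is x ↦ c x + b, then `t` is recovered as
        -- below, and h = c g gives `g`.
        ψ (c , b) = table (λ x → s $ (c ∙ x ✚ b)) , inv c ∙ h

        aut : ∀ {t g} → (t , g) ∈ fib → Aut (t $_)
        aut tg∈ = ∈auts⇒ (proj₁ (∈-cartesianProduct⁻ auts vectors (proj₁ (fib⇒ tg∈))))

        a-$ : ∀ {t g} → (t , g) ∈ fib → ∀ x → a $ (t $ x) ≡ t $ (x ✚ g)
        a-$ {t} {g} tg∈ x = trans (cong (_$ (t $ x)) (sym (proj₂ (fib⇒ tg∈)))) (conjugate-$ (aut tg∈) g x)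

        sA : Aut (s $_)
        sA = aut (here refl)

        covered : ∀ {tg} → tg ∈ fib → tg ∈ map ψ (cartesianProduct units vectors)
        covered {t , g} tg∈ with intertwiner-affine (Aut-∘ (Aut-⁻¹ sA) (aut tg∈)) g≢𝟎 int
          where
          -- For `g ≡ 𝟎` the moment would be `|V| * z 𝟎`, which is zero.
          g≢𝟎 : g ≢ 𝟎
          g≢𝟎 refl = moment≢0 (cong (λ m → m * m) (begin
            moment a                   ≡⟨ cong moment (proj₂ (fib⇒ tg∈)) ⟨
            moment (conjugate (t , 𝟎)) ≡⟨ moment-conjugate (aut tg∈) 𝟎 ⟩
            |V| * z 𝟎                  ≡⟨ cong (|V| *_) z-𝟎 ⟩
            |V| * 0ℤ                   ≡⟨ ℤₚ.*-zeroʳ |V| ⟩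
            0ℤ                         ∎))
          int : Intertwines (λ x → f⁻¹ sA (t $ x)) g h
          int x = begin
            f⁻¹ sA (t $ (x ✚ g))                 ≡⟨ cong (f⁻¹ sA) (a-$ tg∈ x) ⟨
            f⁻¹ sA (a $ (t $ x))                 ≡⟨ cong (λ y → f⁻¹ sA (a $ y)) (inverseʳ sA _) ⟨
            f⁻¹ sA (a $ (s $ f⁻¹ sA (t $ x)))    ≡⟨ cong (f⁻¹ sA) (a-$ (here refl) _) ⟩
            f⁻¹ sA (s $ (f⁻¹ sA (t $ x) ✚ h))    ≡⟨ inverseˡ sA _ ⟩
            f⁻¹ sA (t $ x) ✚ h                   ∎
        ... | c , c≢0 , b , eq = subst (_∈ map ψ (cartesianProduct units vectors)) (cong₂ _,_ t≡ g≡)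
              (∈-map⁺ ψ (∈-cartesianProduct⁺ (∈units c≢0) (𝕍.complete b)))
          where
          s∘k : ∀ x → s $ (c ∙ x ✚ b) ≡ t $ x
          s∘k x = trans (cong (s $_) (sym (eq x))) (inverseʳ sA _)
          t≡ : table (λ x → s $ (c ∙ x ✚ b)) ≡ t
          t≡ = table-unique s∘k
          h≡cg : h ≡ c ∙ g
          h≡cg = ✚-cancelˡ b (injective sA (begin
            s $ (b ✚ h)              ≡⟨ cong (λ y → s $ (y ✚ h)) (sym (trans (cong (_✚ b) (∙𝟎 c)) (✚-identityˡ b))) ⟩
            s $ (c ∙ 𝟎 ✚ b ✚ h)      ≡⟨ a-$ (here refl) _ ⟨
            a $ (s $ (c ∙ 𝟎 ✚ b))    ≡⟨ cong (a $_) (s∘k 𝟎) ⟩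
            a $ (t $ 𝟎)              ≡⟨ a-$ tg∈ 𝟎 ⟩
            t $ (𝟎 ✚ g)              ≡⟨ cong (t $_) (✚-identityˡ g) ⟩
            t $ g                    ≡⟨ s∘k g ⟨
            s $ (c ∙ g ✚ b)          ≡⟨ cong (s $_) (✚-comm _ b) ⟩
            s $ (b ✚ c ∙ g)          ∎))
          g≡ : inv c ∙ h ≡ g
          g≡ = trans (cong (inv c ∙_) h≡cg) (inv-∙ c≢0 g)

      -- The squared moments of the conjugates, summed over all `pairs`, give `|V|` · `|V|` · `|A|`
      -- · `ζ`; by the fibre bound this is at most `|U|` · `|V|` · `Q`. Cancelling `|V|` and
      -- multiplying by `|U|` produces `E`.
      |A|E≤ : |A| * E ≤ |U| * (|U| * Q)
      |A|E≤ = subst (_≤ |U| * (|U| * Q)) (sym regroup) (ℤₚ.*-monoˡ-≤-nonNeg |U|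
        (ℤₚ.*-cancelˡ-≤-pos _ _ |V| {{ℤ.positive (ℤ.+<+ (∈-length (𝕍.complete 𝟎)))}} bound))
        where
        regroup : |A| * E ≡ |U| * (|A| * (|V| * ζ))
        regroup = trans (cong (|A| *_) E-value)
          (ℤS.solve 3 (λ a u x → a ℤS.:* (u ℤS.:* x) ℤS.:= u ℤS.:* (a ℤS.:* x)) refl |A| |U| (|V| * ζ))
          where module ℤS = ℤSolver.+-*-Solver

        total : ∑ pairs (λ tg → moment (conjugate tg) * moment (conjugate tg)) ≡ |V| * (|A| * (|V| * ζ))
        total = begin
          ∑ pairs (λ tg → moment (conjugate tg) * moment (conjugate tg))
            ≡⟨ ∑-cartesianProduct auts vectors _ ⟩
          ∑ auts (λ t → ∑ vectors λ g → moment (conjugate (t , g)) * moment (conjugate (t , g)))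
            ≡⟨ ∑-cong auts (λ t∈ → ∑-cong-≗ vectors λ g →
                 trans (cong (λ m → m * m) (moment-conjugate (∈auts⇒ t∈) g)) (square-* g)) ⟩
          ∑ auts (λ t → ∑ vectors λ g → (|V| * |V|) * (z g * z g))
            ≡⟨ (∑-cong-≗ auts λ t → sym (*-∑ (|V| * |V|) vectors _)) ⟩
          ∑ auts (λ t → (|V| * |V|) * ζ)
            ≡⟨ ∑-const auts _ ⟩
          |A| * ((|V| * |V|) * ζ)
            ≡⟨ ℤS.solve 3 (λ a v x → a ℤS.:* ((v ℤS.:* v) ℤS.:* x) ℤS.:= v ℤS.:* (a ℤS.:* (v ℤS.:* x))) refl |A| |V| ζ ⟩
          |V| * (|A| * (|V| * ζ)) ∎
          where
          module ℤS = ℤSolver.+-*-Solver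
          square-* : ∀ g → |V| * z g * (|V| * z g) ≡ (|V| * |V|) * (z g * z g)
          square-* g = ℤS.solve 2 (λ v x → v ℤS.:* x ℤS.:* (v ℤS.:* x) ℤS.:= (v ℤS.:* v) ℤS.:* (x ℤS.:* x)) refl |V| (z g)

        bound : |V| * (|A| * (|V| * ζ)) ≤ |V| * (|U| * Q)
        bound = subst₂ _≤_ total (begin
          + (length units ℕ.* length vectors) * Q  ≡⟨ cong (_* Q) (ℤₚ.pos-* (length units) (length vectors)) ⟩
          |U| * |V| * Q                            ≡⟨ cong (_* Q) (ℤₚ.*-comm |U| |V|) ⟩
          |V| * |U| * Q                            ≡⟨ ℤₚ.*-assoc |V| |U| Q ⟩
          |V| * (|U| * Q)                          ∎)
          (∑-fibre-≤ _≟ₜ_ conjugate pairs auts! conjugate∈auts (λ t → moment t * moment t)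
             (λ t → square-nonNeg (moment t)) _ (λ {a} _ moment≢0 →
               conjugate-fibre moment≢0 (Uniqueₚ.filter⁺ (λ tg → conjugate tg ≟ₜ a) pairs!)
                 (∈-filter⁻ (λ tg → conjugate tg ≟ₜ a) {xs = pairs})))

      -- `variance` and `|A|E≤` leave no room: the sum of squared deviations is at most 0, so each
      -- deviation is 0.
      average-invariant : ∀ {f} → Aut f → ∀ r b → average b (f r ─ f 𝟎) ≡ average b r
      average-invariant {f} a r b = begin
        average b (f r ─ f 𝟎)          ≡⟨ cong₂ (λ x y → average b (x ─ y)) (table-$ f r) (table-$ f 𝟎) ⟨
        average b (based (table f) r)  ≡⟨ ℤₚ.i-j≡0⇒i≡j _ _ (square-zero _
            (∑-nonNeg-vanish vectors nonNeg₁ (ℤₚ.≤-reflexive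
              (∑-nonNeg-vanish vectors nonNeg₂ (ℤₚ.≤-reflexive
                (∑-nonNeg-vanish auts nonNeg₃ ∑≤0 (table∈auts a)))
              (𝕍.complete r)))
            (𝕍.complete b))) ⟩
        average b r                    ∎
        where
        nonNeg₁ : ∀ {t r} b → 0ℤ ≤ deviation t r b * deviation t r b
        nonNeg₁ b = square-nonNeg (deviation _ _ b)
        nonNeg₂ : ∀ {t} r → 0ℤ ≤ ∑ vectors λ b → deviation t r b * deviation t r b
        nonNeg₂ r = ∑-nonNeg vectors nonNeg₁
        nonNeg₃ : ∀ t → 0ℤ ≤ ∑ vectors λ r → ∑ vectors λ b → deviation t r b * deviation t r b
        nonNeg₃ t = ∑-nonNeg vectors nonNeg₂
        D X : ℤ
        D = ∑₃ λ t r b → deviation t r b * deviation t r b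
        X = |U| * (|U| * Q)
        ∑≤0 : D ≤ 0ℤ
        ∑≤0 = subst₂ _≤_ (trans (cong (ℤ._- (X ℤ.+ X)) (sym variance)) (cancel D (X ℤ.+ X))) (ℤₚ.+-inverseʳ (X ℤ.+ X))
          (ℤₚ.+-monoˡ-≤ (ℤ.- (X ℤ.+ X)) (ℤₚ.+-mono-≤ |A|E≤ |A|E≤))
          where
          module ℤS = ℤSolver.+-*-Solver
          cancel : ∀ d x → d ℤ.+ x ℤ.- x ≡ d
          cancel = ℤS.solve 2 (λ d x → d ℤS.:+ x ℤS.:- x ℤS.:= d) refl

-- Preservation of directions when the connection set is nonconstant off 0

module Lines (F : FiniteField) (n : ℕ) (S : V F n → Bool) (K≤Aut : KLeAut F S) where
  open Graph F n S K≤Aut hiding (_*_; _+_; -_)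
  open Graph F n S K≤Aut using () renaming (_*_ to _*ᶠ_; _+_ to _+ᶠ_; -_ to -ᶠ_)
  open Aut
  open Counting F n S K≤Aut
  open IntegerSums
  open import Data.Integer.Base using (_*_; _+_; _-_; _≤_; _<_; -_; +≤+)
  open VS using (solve; _:=_; _:+_; _:-_)
  private module ℤS = ℤSolver.+-*-Solver

  module Rigid (rigid : ∀ f → Aut f → Normalizes f → Affine f) {x₀ x₁ : Vect}
               (x₀≢𝟎 : x₀ ≢ 𝟎) (Sx₀ : S x₀ ≡ false) (x₁≢𝟎 : x₁ ≢ 𝟎) (Sx₁ : S x₁ ≡ true) where

    -- `χ` is 0 at `𝟎` whatever `S 𝟎` is; automorphisms preserve both functions of a difference, one
    -- through adjacency and one through injectivity.
    δ χ : Vect → ℤ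
    δ x = if does (x ≟ᵥ 𝟎) then 1ℤ else 0ℤ
    χ x = if does (x ≟ᵥ 𝟎) then 0ℤ else if S x then 1ℤ else 0ℤ

    δ-𝟎 : δ 𝟎 ≡ 1ℤ
    δ-𝟎 with 𝟎 ≟ᵥ 𝟎
    ... | yes _ = refl
    ... | no ¬p = ⊥-elim (¬p refl)

    δ-≢𝟎 : ∀ {x} → x ≢ 𝟎 → δ x ≡ 0ℤ
    δ-≢𝟎 {x} x≢𝟎 with x ≟ᵥ 𝟎
    ... | yes x≡𝟎 = ⊥-elim (x≢𝟎 x≡𝟎)
    ... | no  _   = refl

    χ-𝟎 : χ 𝟎 ≡ 0ℤ
    χ-𝟎 with 𝟎 ≟ᵥ 𝟎
    ... | yes _ = refl
    ... | no ¬p = ⊥-elim (¬p refl)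

    χ-≢𝟎 : ∀ {x} → x ≢ 𝟎 → χ x ≡ (if S x then 1ℤ else 0ℤ)
    χ-≢𝟎 {x} x≢𝟎 with x ≟ᵥ 𝟎
    ... | yes x≡𝟎 = ⊥-elim (x≢𝟎 x≡𝟎)
    ... | no  _   = refl

    s N : ℤ
    s = ∑ vectors χ
    N = |V| - 1ℤ

    -- The combination of the indicators of S ∖ 0, of its complement and of 0 which
    -- vanishes at 0 and has sum 0.
    z : Vect → ℤ
    z x = N * χ x + s * δ x - s

    ─-≢𝟎 : ∀ {f} → Aut f → ∀ {u v} → u ─ v ≢ 𝟎 → f u ─ f v ≢ 𝟎
    ─-≢𝟎 a u≢v eq = u≢v (trans (cong (_─ _) (injective a (─-cancel eq))) (─-self _))

    z-invariant : ∀ {f} → Aut f → ∀ u v → z (f u ─ f v) ≡ z (u ─ v)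
    z-invariant {f} a u v = cases ((u ─ v) ≟ᵥ 𝟎)
      where
      cases : Dec (u ─ v ≡ 𝟎) → z (f u ─ f v) ≡ z (u ─ v)
      cases (yes eq) = cong z (trans (cong (λ x → f x ─ f v) (─-cancel eq)) (trans (─-self (f v)) (sym eq)))
      cases (no ne)  = cong₂ (λ c d → N * c + s * d - s)
        (trans (χ-≢𝟎 (─-≢𝟎 a ne)) (trans (cong (if_then 1ℤ else 0ℤ) (sym (adjacent a u v))) (sym (χ-≢𝟎 ne))))
        (trans (δ-≢𝟎 (─-≢𝟎 a ne)) (sym (δ-≢𝟎 ne)))

    z-𝟎 : z 𝟎 ≡ 0ℤ
    z-𝟎 = trans (cong₂ (λ c d → N * c + s * d - s) χ-𝟎 δ-𝟎)
      (ℤS.solve 2 (λ N s → N ℤS.:* ℤS.con 0ℤ ℤS.:+ s ℤS.:* ℤS.con 1ℤ ℤS.:- s ℤS.:= ℤS.con 0ℤ) refl N s)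

    ∑-combination : ∀ {I : Set} (xs : List I) (f g : I → ℤ) a b c →
      ∑ xs (λ x → a * f x + b * g x - c) ≡ a * ∑ xs f + b * ∑ xs g - + length xs * c
    ∑-combination xs f g a b c = begin
      ∑ xs (λ x → a * f x + b * g x + - c)                             ≡⟨ ∑-distrib xs _ _ ⟩
      ∑ xs (λ x → a * f x + b * g x) + ∑ xs (λ _ → - c)                ≡⟨ cong₂ _+_ (∑-distrib xs _ _) (∑-const xs (- c)) ⟩
      ∑ xs (λ x → a * f x) + ∑ xs (λ x → b * g x) + + length xs * - c  ≡⟨ cong₂ (λ i j → i + j + + length xs * - c)
                                                                            (*-∑ a xs f) (*-∑ b xs g) ⟨
      a * ∑ xs f + b * ∑ xs g + + length xs * - c                      ≡⟨ cong (λ i → a * ∑ xs f + b * ∑ xs g + i)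
                                                                            (ℤₚ.neg-distribʳ-* (+ length xs) c) ⟨
      a * ∑ xs f + b * ∑ xs g - + length xs * c                        ∎
      where open ≡-Reasoning

    ∑δ : ∑ vectors δ ≡ 1ℤ
    ∑δ = trans (∑-single 𝕍.unique (𝕍.complete 𝟎) δ (λ _ → δ-≢𝟎)) δ-𝟎

    ∑z : ∑ vectors z ≡ 0ℤ
    ∑z = trans (∑-combination vectors χ δ N s s)
      (trans (cong (λ d → N * s + s * d - |V| * s) ∑δ)
        (ℤS.solve 2 (λ V s → (V ℤS.:- ℤS.con 1ℤ) ℤS.:* s ℤS.:+ s ℤS.:* ℤS.con 1ℤ ℤS.:- V ℤS.:* s ℤS.:= ℤS.con 0ℤ)
          refl |V| s))

    0<s : 0ℤ < s
    0<s = ℤₚ.≰⇒> λ s≤0 → 1≢0 (trans (sym χx₁) (∑-nonNeg-vanish vectors 0≤χ s≤0 (𝕍.complete x₁)))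
      where
      1≢0 : 1ℤ ≢ 0ℤ
      1≢0 ()
      χx₁ : χ x₁ ≡ 1ℤ
      χx₁ = trans (χ-≢𝟎 x₁≢𝟎) (cong (if_then 1ℤ else 0ℤ) Sx₁)
      0≤χ : ∀ x → 0ℤ ≤ χ x
      0≤χ x with x ≟ᵥ 𝟎 | S x
      ... | yes _ | _     = ℤₚ.≤-refl
      ... | no  _ | true  = +≤+ ℕ.z≤n
      ... | no  _ | false = ℤₚ.≤-refl

    s<N : s < N
    s<N = ℤₚ.≰⇒> λ N≤s → 1≢0 (trans (sym complement-x₀)
        (∑-nonNeg-vanish vectors 0≤complement (≤0 N≤s) (𝕍.complete x₀)))
      where
      1≢0 : 1ℤ ≢ 0ℤ
      1≢0 ()
      -- The indicator of the nonzero vectors outside `S`, spelled with coefficients -1 so that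
      -- `∑-combination` evaluates its sum to `N - s`.
      complement : Vect → ℤ
      complement x = - 1ℤ * χ x + - 1ℤ * δ x - - 1ℤ
      complement-x₀ : complement x₀ ≡ 1ℤ
      complement-x₀ = cong₂ (λ c d → - 1ℤ * c + - 1ℤ * d - - 1ℤ)
        (trans (χ-≢𝟎 x₀≢𝟎) (cong (if_then 1ℤ else 0ℤ) Sx₀)) (δ-≢𝟎 x₀≢𝟎)
      0≤complement : ∀ x → 0ℤ ≤ complement x
      0≤complement x with x ≟ᵥ 𝟎 | S x
      ... | yes _ | _     = ℤₚ.≤-refl
      ... | no  _ | true  = ℤₚ.≤-refl
      ... | no  _ | false = +≤+ ℕ.z≤n
      ≤0 : N ≤ s → ∑ vectors complement ≤ 0ℤ
      ≤0 N≤s = subst (_≤ 0ℤ) (sym (trans (∑-combination vectors χ δ (- 1ℤ) (- 1ℤ) (- 1ℤ))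
          (trans (cong (λ d → - 1ℤ * s + - 1ℤ * d - |V| * - 1ℤ) ∑δ)
            (ℤS.solve 2 (λ V s → ℤS.con (- 1ℤ) ℤS.:* s ℤS.:+ ℤS.con (- 1ℤ) ℤS.:* ℤS.con 1ℤ ℤS.:- V ℤS.:* ℤS.con (- 1ℤ)
                                  ℤS.:= V ℤS.:- ℤS.con 1ℤ ℤS.:- s) refl |V| s))))
        (subst (N - s ≤_) (ℤₚ.+-inverseʳ s) (ℤₚ.+-monoˡ-≤ (- s) N≤s))

    no-multiple : ∀ k → N * k ≢ s
    no-multiple k Nk≡s with k ℤₚ.≤? 0ℤ
    ... | yes k≤0 = ℤₚ.<⇒≱ 0<s (subst₂ _≤_ Nk≡s (ℤₚ.*-zeroʳ N) (ℤₚ.*-monoˡ-≤-nonNeg N {{N≥0}} k≤0))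
      where N≥0 = ℤ.nonNegative (ℤₚ.<⇒≤ (ℤₚ.<-trans 0<s s<N))
    ... | no  k≰0 = ℤₚ.<⇒≱ s<N (subst₂ _≤_ (ℤₚ.*-identityʳ N) Nk≡s
                      (ℤₚ.*-monoˡ-≤-nonNeg N {{N≥0}} (ℤₚ.i<j⇒suc[i]≤j (ℤₚ.≰⇒> k≰0))))
      where N≥0 = ℤ.nonNegative (ℤₚ.<⇒≤ (ℤₚ.<-trans 0<s s<N))

    open Moments z z-invariant z-𝟎 ∑z

    -- Compare `average r r′` with `average r r`. If r is no multiple of r′, then no difference r -
    -- c r′ is 0, whereas r - c r is 0 exactly for c = 1. The constants -s agree on both sides,
    -- which leaves N P′ = N P + s.
    preserves-lines : ∀ {f} → Aut f → ∀ r → ∃ λ c → c ≢ 0# × r ≡ c ∙ (f r ─ f 𝟎)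
    preserves-lines {f} a r with 𝔽.any? (λ c → ¬? (c ≟ 0#) ×-dec (r ≟ᵥ (c ∙ (f r ─ f 𝟎))))
    ... | yes found = found
    ... | no  none  = ⊥-elim (no-multiple (P′ - P) (begin
        N * (P′ - P)
          ≡⟨ ℤS.solve 4 (λ N s P P′ → N ℤS.:* (P′ ℤS.:- P) ℤS.:= (N ℤS.:* P′ ℤS.:+ s ℤS.:* ℤS.con 0ℤ)
               ℤS.:- (N ℤS.:* P ℤS.:+ s ℤS.:* ℤS.con 1ℤ) ℤS.:+ s) refl N s P P′ ⟩
        (N * P′ + s * 0ℤ) - (N * P + s * 1ℤ) + s
          ≡⟨ cong (λ i → i - (N * P + s * 1ℤ) + s) sums-equal ⟩
        (N * P + s * 1ℤ) - (N * P + s * 1ℤ) + s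
          ≡⟨ cong (_+ s) (ℤₚ.+-inverseʳ (N * P + s * 1ℤ)) ⟩
        0ℤ + s
          ≡⟨ ℤₚ.+-identityˡ s ⟩
        s ∎))
      where
      open ≡-Reasoning
      r′ : Vect
      r′ = f r ─ f 𝟎
      P P′ : ℤ
      P  = ∑ units λ c → χ (r ─ c ∙ r)
      P′ = ∑ units λ c → χ (r ─ c ∙ r′)

      r≢𝟎 : r ≢ 𝟎
      -- For r = 0 also r′ = 0, and the factor 1 would do.
      r≢𝟎 refl = none (1# , 0≢1 ∘ sym , sym (trans (1∙ r′) (─-self (f 𝟎))))

      δ-vanishes : ∑ units (λ c → δ (r ─ c ∙ r′)) ≡ 0ℤ
      δ-vanishes = ∑-ε units λ {c} c∈ → δ-≢𝟎 λ eq → none (c , ∈units⇒ c∈ , ─-cancel eq)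

      δ-once : ∑ units (λ c → δ (r ─ c ∙ r)) ≡ 1ℤ
      δ-once = trans
        (∑-single units! (∈units (0≢1 ∘ sym)) _ λ _ c≢1 → δ-≢𝟎 λ eq →
          c≢1 (∙-cancelʳ r≢𝟎 (trans (sym (─-cancel eq)) (sym (1∙ r)))))
        (trans (cong δ (trans (cong (r ─_) (1∙ r)) (─-self r))) δ-𝟎)

      sums-equal : N * P′ + s * 0ℤ ≡ N * P + s * 1ℤ
      sums-equal = ℤ-Group.∙-cancelʳ (- (|U| * s)) _ _ (begin
        N * P′ + s * 0ℤ - |U| * s                                      ≡⟨ cong (λ d → N * P′ + s * d - |U| * s) δ-vanishes ⟨
        N * P′ + s * ∑ units (λ c → δ (r ─ c ∙ r′)) - |U| * s          ≡⟨ ∑-combination units _ _ N s s ⟨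
        average r r′                                                   ≡⟨ average-invariant rigid a r r ⟩
        average r r                                                    ≡⟨ ∑-combination units _ _ N s s ⟩
        N * P + s * ∑ units (λ c → δ (r ─ c ∙ r)) - |U| * s            ≡⟨ cong (λ d → N * P + s * d - |U| * s) δ-once ⟩
        N * P + s * 1ℤ - |U| * s                                       ∎)

    -- The base point is moved from `𝟎` to `y` by composing `f` with a translation.
    preserves-directions : ∀ {f} → Aut f → ∀ x y → ∃ λ c → c ≢ 0# × f x ─ f y ≡ c ∙ (x ─ y)
    preserves-directions {f} a x y with preserves-lines (Aut-∘ a (Aut-✚ y)) (x ─ y)
    ... | c , c≢0 , eq = c ⁻¹⟨ c≢0 ⟩ , ⁻¹-≢0 c≢0 , (begin
      f x ─ f y                                        ≡⟨ ∙-inverse′ c≢0 _ ⟨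
      c ⁻¹⟨ c≢0 ⟩ ∙ (c ∙ (f x ─ f y))                  ≡⟨ cong₂ (λ u v → c ⁻¹⟨ c≢0 ⟩ ∙ (c ∙ (f u ─ f v)))
          (solve 2 (λ x y → x := x :- y :+ y) refl x y) (sym (✚-identityˡ y)) ⟩
      c ⁻¹⟨ c≢0 ⟩ ∙ (c ∙ (f (x ─ y ✚ y) ─ f (𝟎 ✚ y)))  ≡⟨ cong (c ⁻¹⟨ c≢0 ⟩ ∙_) eq ⟨
      c ⁻¹⟨ c≢0 ⟩ ∙ (x ─ y)                            ∎)
      where open ≡-Reasoning

    -- From preserved directions to affine maps

    module _ {e₀ e₁ : Vect} (e₀≢𝟎 : e₀ ≢ 𝟎) (e₁≢𝟎 : e₁ ≢ 𝟎)
             (independent : ∀ c d → c ∙ e₀ ≡ d ∙ e₁ → c ∙ e₀ ≡ 𝟎) where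

      Aut⇒Affine : ∀ {f} → Aut f → Affine f
      Aut⇒Affine {f} a with preserves-directions a e₀ 𝟎
      ... | c , c≢0 , eq₀ = c , c≢0 , f 𝟎 , λ x →
          trans (solve 2 (λ u v → u := u :- v :+ v) refl (f x) (f 𝟎)) (cong (_✚ f 𝟎) (homothety x))
        where
        f₀ : Vect → Vect
        f₀ x = f x ─ f 𝟎

        f₀-scales : ∀ x → ∃ λ d → f₀ x ≡ d ∙ x
        f₀-scales x with preserves-directions a x 𝟎
        ... | d , _ , eq = d , trans eq (cong (d ∙_) (─-𝟎 x))

        f₀e₀ : f₀ e₀ ≡ c ∙ e₀
        f₀e₀ = trans eq₀ (cong (c ∙_) (─-𝟎 e₀))

        -- With k the factor of x - y, the equation d x - e y = k (x - y) reads (d - k) x = (e - k)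
        -- y. As x is no multiple of y, d = k; then (e - k) y = 0.
        same-factor : ∀ {x y d e} → y ≢ 𝟎 → (∀ k → x ≢ k ∙ y) → f₀ x ≡ d ∙ x → f₀ y ≡ e ∙ y → d ≡ e
        same-factor {x} {y} {d} {e} y≢𝟎 x∉y f₀x f₀y with preserves-directions a x y
        ... | k , _ , eq = trans d≡k (sym (+-cancel (decidable-stable (_ ≟ _) λ e-k≢0 → y≢𝟎 (∙≡𝟎
                (trans (sym relation) (trans (cong (λ i → (i +ᶠ -ᶠ k) ∙ x) d≡k)
                   (trans (-‿distrib-∙ k k x) (─-self _)))) e-k≢0))))
          where
          open ≡-Reasoning
          relation : (d +ᶠ -ᶠ k) ∙ x ≡ (e +ᶠ -ᶠ k) ∙ y
          relation = begin
            (d +ᶠ -ᶠ k) ∙ x                    ≡⟨ -‿distrib-∙ d k x ⟩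
            d ∙ x ─ k ∙ x                      ≡⟨ cong (_─ k ∙ x) f₀x ⟨
            f x ─ f 𝟎 ─ k ∙ x                  ≡⟨ solve 4 (λ x y o u → x :- o :- u := x :- y :+ (y :- o) :- u) refl (f x) (f y) (f 𝟎) (k ∙ x) ⟩
            (f x ─ f y) ✚ f₀ y ─ k ∙ x         ≡⟨ cong₂ (λ u v → u ✚ v ─ k ∙ x) (trans eq (∙-distrib-─ k x y)) f₀y ⟩
            (k ∙ x ─ k ∙ y) ✚ e ∙ y ─ k ∙ x    ≡⟨ solve 3 (λ x y w → x :- y :+ w :- x := w :- y) refl (k ∙ x) (k ∙ y) (e ∙ y) ⟩
            e ∙ y ─ k ∙ y                      ≡⟨ -‿distrib-∙ e k y ⟨
            (e +ᶠ -ᶠ k) ∙ y                    ∎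
          d≡k : d ≡ k
          d≡k = +-cancel (decidable-stable (_ ≟ _) λ d-k≢0 → x∉y (factor d-k≢0) (begin
            x                                            ≡⟨ ∙-inverse′ d-k≢0 x ⟨
            (d +ᶠ -ᶠ k) ⁻¹⟨ d-k≢0 ⟩ ∙ ((d +ᶠ -ᶠ k) ∙ x)  ≡⟨ cong (_ ∙_) relation ⟩
            (d +ᶠ -ᶠ k) ⁻¹⟨ d-k≢0 ⟩ ∙ ((e +ᶠ -ᶠ k) ∙ y)  ≡⟨ ∙-assoc _ _ y ⟨
            factor d-k≢0 ∙ y                              ∎))
            where
            factor : d +ᶠ -ᶠ k ≢ 0# → Carrier
            factor ne = (d +ᶠ -ᶠ k) ⁻¹⟨ ne ⟩ *ᶠ (e +ᶠ -ᶠ k)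

        homothety : ∀ x → f₀ x ≡ c ∙ x
        homothety x with f₀-scales x | 𝔽.any? (λ k → x ≟ᵥ (k ∙ e₀)) | x ≟ᵥ 𝟎
        ... | d , f₀x | no x∉e₀       | _        = trans f₀x (cong (_∙ x) (same-factor e₀≢𝟎 (λ k eq → x∉e₀ (k , eq)) f₀x f₀e₀))
        ... | _       | _             | yes refl = trans (─-self (f 𝟎)) (sym (∙𝟎 c))
        -- On the line of `e₀` the vector cannot be compared with `e₀` itself; the factor is passed
        -- on through `e₁`, which is where a second dimension is used.
        ... | d , f₀x | yes (k , x≡)  | no x≢𝟎  with f₀-scales e₁
        ...   | e , f₀e₁ = trans f₀x (cong (_∙ x) (trans (same-factor e₁≢𝟎 x∉e₁ f₀x f₀e₁) (same-factor e₀≢𝟎 e₁∉e₀ f₀e₁ f₀e₀)))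
          where
          x∉e₁ : ∀ l → x ≢ l ∙ e₁
          x∉e₁ l eq = x≢𝟎 (trans x≡ (independent k l (trans (sym x≡) eq)))
          e₁∉e₀ : ∀ l → e₁ ≢ l ∙ e₀
          e₁∉e₀ l eq = e₁≢𝟎 (trans eq (independent l 1# (trans (sym eq) (sym (1∙ e₁)))))

-- The dichotomy, settled by finite search

theorem1p2 : (F : FiniteField) → (n : ℕ) → n ≥ 2 →
    (S : V F n → Bool) →
    (∀ x → S x ≡ S (⊖_ F x)) →
    KLeAut F S →
    ((φ : Perm F n) → IsAut F S φ → InK F φ)
    ⊎ Σ (Perm F n) (λ φ → IsAut F S φ × ¬ InK F φ × NormalizesG F φ)
theorem1p2 F (suc (suc m)) (ℕ.s≤s (ℕ.s≤s _)) S _ K≤Aut = conclusion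
  where
  open Graph F (suc (suc m)) S K≤Aut
  open Aut

  Affine? : Decidable (λ (t : Table Vect) → Affine (t $_))
  Affine? t = 𝔽.any? λ c → ¬? (c ≟ 0#) ×-dec 𝕍.any? λ b → 𝕍.all? λ x → (t $ x) ≟ᵥ (c ∙ x ✚ b)
    where module 𝔽 = Enumeration enumerate-field

  Normalizes? : Decidable (λ (t : Table Vect) → Normalizes (t $_))
  Normalizes? t = (𝕍.all? λ b → 𝕍.any? λ c → shifts? b c) ×-dec (𝕍.all? λ c → 𝕍.any? λ b → shifts? b c)
    where
    shifts? : ∀ b c → Dec (∀ x → t $ (x ✚ b) ≡ t $ x ✚ c)
    shifts? b c = 𝕍.all? λ x → (t $ (x ✚ b)) ≟ᵥ (t $ x ✚ c)

  Conclusion : Set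
  Conclusion = ((φ : Perm F (suc (suc m))) → IsAut F S φ → InK F φ)
    ⊎ Σ (Perm F (suc (suc m))) (λ φ → IsAut F S φ × ¬ InK F φ × NormalizesG F φ)

  exceptional : ∀ {f} → Aut f → ¬ Affine f → Normalizes f → Conclusion
  exceptional {f} a ¬K (forth , back) = inj₂
    ( mk↔ₛ′ f (f⁻¹ a) (inverseʳ a) (inverseˡ a)
    , (λ u v → mk⇔ (trans (sym (adjacent a u v))) (trans (adjacent a u v)))
    , ¬K
    , (λ b → let (c , eq) = forth b in c , λ x → trans (eq _) (cong (_✚ c) (inverseʳ a x)))
    , (λ c → let (b , eq) = back c in b , λ x → trans (eq _) (cong (_✚ c) (inverseʳ a x))))

  Perm⇒Aut : ∀ φ → IsAut F S φ → Aut (Inverse.to φ)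
  Perm⇒Aut φ aut = record
    { f⁻¹      = Inverse.from φ
    ; inverseˡ = Inverse.strictlyInverseʳ φ
    ; inverseʳ = Inverse.strictlyInverseˡ φ
    ; adjacent = λ u v → ≡true⇒≡ (Equivalence.to (aut u v)) (Equivalence.from (aut u v))
    }

  swap : Vect → Vect
  swap (x ∷ y ∷ v) = y ∷ x ∷ v

  swap-involutive : ∀ x → swap (swap x) ≡ x
  swap-involutive (x ∷ y ∷ v) = refl

  swap-✚ : ∀ x b → swap (x ✚ b) ≡ swap x ✚ swap b
  swap-✚ (x ∷ y ∷ v) (b ∷ c ∷ w) = refl

  e₀ e₁ : Vect
  e₀ = 1# ∷ 0# ∷ Vec.replicate m 0#
  e₁ = 0# ∷ 1# ∷ Vec.replicate m 0#

  second : Vect → Carrier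
  second x = Vec.head (Vec.tail x)

  swap-normalizes : Normalizes swap
  swap-normalizes = (λ b → swap b , λ x → swap-✚ x b)
                  , (λ c → swap c , λ x → trans (swap-✚ x _) (cong (swap x ✚_) (swap-involutive c)))

  -- `𝟎` and `e₀` agree in the second coordinate, and so do their images under x ↦ c x + b; after
  -- `swap` these coordinates are 0 and 1.
  swap-not-affine : ¬ Affine swap
  swap-not-affine (c , _ , b₀ ∷ b₁ ∷ b , eq) = 0≢1 (trans (cong second (eq 𝟎)) (sym (cong second (eq e₀))))

  e₀≢𝟎 : e₀ ≢ 𝟎
  e₀≢𝟎 eq = 0≢1 (sym (cong Vec.head eq))

  e₁≢𝟎 : e₁ ≢ 𝟎
  e₁≢𝟎 eq = 0≢1 (sym (cong second eq))

  independent : ∀ c d → c ∙ e₀ ≡ d ∙ e₁ → c ∙ e₀ ≡ 𝟎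
  independent c d eq = trans (cong (_∙ e₀) c≡0) (0∙ e₀)
    where
    c≡0 : c ≡ 0#
    c≡0 = trans (sym (*-identityʳ c)) (trans (cong Vec.head eq) (zeroʳ d))

  -- Adjacency of distinct vertices does not depend on the pair here, so injectivity of `swap`
  -- suffices.
  swap-Aut : (∀ {x y} → x ≢ 𝟎 → y ≢ 𝟎 → S x ≡ S y) → Aut swap
  swap-Aut constant = record
    { f⁻¹ = swap ; inverseˡ = swap-involutive ; inverseʳ = swap-involutive ; adjacent = adj }
    where
    swap-injective : ∀ {x y} → swap x ≡ swap y → x ≡ y
    swap-injective eq = trans (sym (swap-involutive _)) (trans (cong swap eq) (swap-involutive _))
    adj : ∀ u v → S (u ─ v) ≡ S (swap u ─ swap v)
    adj u v with u ≟ᵥ v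
    ... | yes refl = cong S (trans (─-self u) (sym (─-self (swap u))))
    ... | no u≢v   = constant (u≢v ∘ ─-cancel) (u≢v ∘ swap-injective ∘ ─-cancel)

  nonconstant : (∀ f → Aut f → Normalizes f → Affine f) →
    (∃ λ x → x ≢ 𝟎 × S x ≡ true) → (∃ λ x → x ≢ 𝟎 × S x ≡ false) → Conclusion
  nonconstant rigid (x₁ , x₁≢𝟎 , Sx₁) (x₀ , x₀≢𝟎 , Sx₀) = inj₁ λ φ aut →
    Lines.Rigid.Aut⇒Affine F (suc (suc m)) S K≤Aut rigid x₀≢𝟎 Sx₀ x₁≢𝟎 Sx₁ e₀≢𝟎 e₁≢𝟎 independent (Perm⇒Aut φ aut)

  constant-off-𝟎 : ∀ b → ¬ (∃ λ x → x ≢ 𝟎 × S x ≡ b) → Conclusion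
  constant-off-𝟎 b none = exceptional
    (swap-Aut λ x≢𝟎 y≢𝟎 → trans (value x≢𝟎) (sym (value y≢𝟎))) swap-not-affine swap-normalizes
    where
    value : ∀ {x} → x ≢ 𝟎 → S x ≡ not b
    value x≢𝟎 = Boolₚ.¬-not λ eq → none (_ , x≢𝟎 , eq)

  -- All case distinctions are exhaustive searches, over tables for a normalizing automorphism
  -- outside K and over vectors for the two values of `S` off `𝟎`, so no excluded middle is assumed.
  conclusion : Conclusion
  conclusion with 𝕋.any? (λ t → Aut? t ×-dec ¬? (Affine? t) ×-dec Normalizes? t)
                | 𝕍.any? (λ x → ¬? (x ≟ᵥ 𝟎) ×-dec (S x Boolₚ.≟ true))
                | 𝕍.any? (λ x → ¬? (x ≟ᵥ 𝟎) ×-dec (S x Boolₚ.≟ false))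
  ... | yes (t , a , ¬K , norm) | _         | _         = exceptional a ¬K norm
  ... | no _                    | no none   | _         = constant-off-𝟎 true none
  ... | no _                    | yes _     | no none   = constant-off-𝟎 false none
  ... | no none                 | yes some₁ | yes some₀ = nonconstant rigid some₁ some₀
    where
    rigid : ∀ f → Aut f → Normalizes f → Affine f
    -- The failed search speaks of tables; an arbitrary automorphism is tabulated first, and its
    -- affine form is read back pointwise.
    rigid f a (forth , back) = affine (decidable-stable (Affine? (table f)) λ ¬K →
        none (table f , Aut-table a , ¬K , (λ b → let (c , eq) = forth b in c , shift eq)
                                         , (λ c → let (b , eq) = back c in b , shift eq)))
      where
      shift : ∀ {b c} → Intertwines f b c → Intertwines (table f $_) b c
      shift eq x = trans (table-$ f _) (trans (eq x) (cong (_✚ _) (sym (table-$ f x))))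
      affine : Affine (table f $_) → Affine f
      affine (c , c≢0 , b , eq) = c , c≢0 , b , λ x → trans (sym (table-$ f x)) (eq x)
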